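{- For every integer $n\geq1$, $$\nu_5(5n+4)\equiv0\pmod5,\qquad \nu_7(7n+5)\equiv0\pmod7,\qquad \nu_{11}(11n+6)\equiv0\pmod{11}.$$
   Context: For $k\geq1$, $\nu_k(n)$ denotes the number of integer partitions of $n$ having no part equal to $k$. -}

module Defs where

open import Data.Nat using (ℕ; zero; suc; _+_; _∸_; _≤_; _<_; _≥_; z≤n; s≤s; s≤s⁻¹; _≤?_)
open import Data.Nat.Properties
  using (_≟_; ≤-refl; ≤-trans; m+[n∸m]≡n; m+n∸m≡n; m≤m+n; m≤n⇒m≤1+n; m≤n⇒m<n∨m≡n; n≮n; +-mono-≤)
open import Data.List using (List; []; _∷_; _++_; map; filter; length)
open import Data.Nat.ListAction using (sum)
open import Data.List.Properties using (∷-injectiveʳ)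
open import Data.List.Relation.Unary.All as All using (All; []; _∷_)
open import Data.List.Relation.Unary.AllPairs using (AllPairs; []; _∷_)
open import Data.List.Relation.Unary.Any using (here)
open import Data.List.Relation.Unary.Unique.Propositional using (Unique)
import Data.List.Relation.Unary.Unique.Propositional.Properties as Unique
open import Data.List.Membership.Propositional.Properties
  using (∈-map⁺; ∈-map⁻; ∈-++⁺ˡ; ∈-++⁺ʳ; ∈-++⁻; ∈-filter⁺; ∈-filter⁻)
open import Data.List.Membership.Propositional using (_∈_; _∉_)
open import Data.List.Membership.DecPropositional _≟_ using (_∉?_)
open import Data.Product using (_×_; _,_; proj₁; proj₂)
open import Data.Sum using (inj₁; inj₂)
open import Data.Empty using (⊥-elim)
open import Function using (_⇔_; mk⇔; module Equivalence)
open import Relation.Nullary using (yes; no)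
open import Relation.Binary.PropositionalEquality using (_≡_; refl; sym; trans; cong; subst)

record IsPartition (n : ℕ) (parts : List ℕ) : Set where
  constructor isPartition
  field
    positive       : All (0 <_) parts
    non-increasing : AllPairs _≥_ parts
    sums-to        : sum parts ≡ n

-- The partitions of n into at most ℓ parts, each of size at most b.
-- For b > 0 either no part equals b, or the first part is b and the rest
-- is a partition of n ∸ b into at most ℓ ∸ 1 parts of size at most b.
boundedPartitions : (ℓ b n : ℕ) → List (List ℕ)
boundedPartitions zero    b       zero    = [] ∷ []
boundedPartitions zero    b       (suc n) = []
boundedPartitions (suc ℓ) zero    zero    = [] ∷ []
boundedPartitions (suc ℓ) zero    (suc n) = []
boundedPartitions (suc ℓ) (suc b) n with suc b ≤? n
... | yes _ = boundedPartitions (suc ℓ) b n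
              ++ map (suc b ∷_) (boundedPartitions ℓ (suc b) (n ∸ suc b))
... | no  _ = boundedPartitions (suc ℓ) b n

-- A partition of n has at most n parts, each at most n, so these are all the
-- partitions of n; see ∈-partitions and partitions-unique.
partitions : ℕ → List (List ℕ)
partitions n = boundedPartitions n n n

partitionsAvoiding : ℕ → ℕ → List (List ℕ)
partitionsAvoiding k n = filter (k ∉?_) (partitions n)

-- The number of partitions of n having no part equal to k; see
-- ∈-partitionsAvoiding and partitionsAvoiding-unique.
ν : (k n : ℕ) → ℕ
ν k n = length (partitionsAvoiding k n)

private
  empty : ∀ {b} → IsPartition 0 [] × All (_≤ b) []
  empty = isPartition [] [] refl , []

  sound : ∀ ℓ b n {p} → p ∈ boundedPartitions ℓ b n → IsPartition n p × All (_≤ b) p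
  sound zero    b       zero    (here refl) = empty
  sound (suc ℓ) zero    zero    (here refl) = empty
  sound (suc ℓ) (suc b) n       p∈ with suc b ≤? n
  sound (suc ℓ) (suc b) n       p∈ | no _ with sound (suc ℓ) b n p∈
  ... | isP , p≤b = isP , All.map m≤n⇒m≤1+n p≤b
  sound (suc ℓ) (suc b) n       p∈ | yes b<n with ∈-++⁻ (boundedPartitions (suc ℓ) b n) p∈
  ... | inj₁ p∈ˡ with sound (suc ℓ) b n p∈ˡ
  ...   | isP , p≤b = isP , All.map m≤n⇒m≤1+n p≤b
  sound (suc ℓ) (suc b) n       p∈ | yes b<n | inj₂ p∈ʳ with ∈-map⁻ (suc b ∷_) p∈ʳ
  ... | q , q∈ , refl with sound ℓ (suc b) (n ∸ suc b) q∈
  ...   | isPartition pos dec eq , q≤b =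
          isPartition (s≤s z≤n ∷ pos) (q≤b ∷ dec) (trans (cong (suc b +_) eq) (m+[n∸m]≡n b<n))
          , ≤-refl ∷ q≤b

  complete : ∀ ℓ b n {p} → IsPartition n p → length p ≤ ℓ → All (_≤ b) p →
             p ∈ boundedPartitions ℓ b n
  complete zero    b       n {[]}    (isPartition _ _ refl) _ _ = here refl
  complete (suc ℓ) zero    n {[]}    (isPartition _ _ refl) _ _ = here refl
  complete (suc ℓ) zero    n {x ∷ p} (isPartition (0<x ∷ _) _ _) _ (x≤0 ∷ _) =
    ⊥-elim (n≮n 0 (≤-trans 0<x x≤0))
  complete (suc ℓ) (suc b) n {[]}    isP@(isPartition _ _ refl) len [] =
    complete (suc ℓ) b 0 isP len []
  complete (suc ℓ) (suc b) n {x ∷ p} isP@(isPartition (_ ∷ pos) (p≤x ∷ dec) eq) len (x≤b ∷ _)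
    with suc b ≤? n | m≤n⇒m<n∨m≡n x≤b
  ... | yes _  | inj₁ x<1+b =
    ∈-++⁺ˡ (complete (suc ℓ) b n isP len
             (s≤s⁻¹ x<1+b ∷ All.map (λ y≤x → ≤-trans y≤x (s≤s⁻¹ x<1+b)) p≤x))
  ... | no _   | inj₁ x<1+b =
    complete (suc ℓ) b n isP len
      (s≤s⁻¹ x<1+b ∷ All.map (λ y≤x → ≤-trans y≤x (s≤s⁻¹ x<1+b)) p≤x)
  ... | yes _  | inj₂ refl  =
    ∈-++⁺ʳ (boundedPartitions (suc ℓ) b n)
      (∈-map⁺ (suc b ∷_) (complete ℓ (suc b) (n ∸ suc b)
        (isPartition pos dec (trans (sym (m+n∸m≡n (suc b) (sum p))) (cong (_∸ suc b) eq)))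
        (s≤s⁻¹ len) p≤x))
  ... | no b≮n | inj₂ refl  = ⊥-elim (b≮n (subst (suc b ≤_) eq (m≤m+n (suc b) (sum p))))

  unique : ∀ ℓ b n → Unique (boundedPartitions ℓ b n)
  unique zero    b       zero    = [] ∷ []
  unique zero    b       (suc n) = []
  unique (suc ℓ) zero    zero    = [] ∷ []
  unique (suc ℓ) zero    (suc n) = []
  unique (suc ℓ) (suc b) n with suc b ≤? n
  ... | no  _ = unique (suc ℓ) b n
  ... | yes _ =
    Unique.++⁺ (unique (suc ℓ) b n)
      (Unique.map⁺ ∷-injectiveʳ (unique ℓ (suc b) (n ∸ suc b)))
      disjoint
    where
    disjoint : ∀ {p} → p ∈ boundedPartitions (suc ℓ) b n ×
                       p ∈ map (suc b ∷_) (boundedPartitions ℓ (suc b) (n ∸ suc b)) → _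
    disjoint (p∈ˡ , p∈ʳ) with ∈-map⁻ (suc b ∷_) p∈ʳ
    ... | q , _ , refl = n≮n b (All.head (proj₂ (sound (suc ℓ) b n p∈ˡ)))

  length≤sum : ∀ {p} → All (0 <_) p → length p ≤ sum p
  length≤sum []          = z≤n
  length≤sum (0<x ∷ pos) = +-mono-≤ 0<x (length≤sum pos)

  parts≤sum : ∀ p → All (_≤ sum p) p
  parts≤sum []      = []
  parts≤sum (x ∷ p) =
    m≤m+n x (sum p) ∷ All.map (λ y≤s → ≤-trans y≤s (+-mono-≤ (z≤n {x}) ≤-refl)) (parts≤sum p)

∈-partitions : ∀ n {p} → p ∈ partitions n ⇔ IsPartition n p
∈-partitions n = mk⇔ (λ p∈ → proj₁ (sound n n n p∈)) from
  where
  from : ∀ {p} → IsPartition n p → p ∈ partitions n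
  from {p} isP@(isPartition pos _ refl) = complete n n n isP (length≤sum pos) (parts≤sum p)

partitions-unique : ∀ n → Unique (partitions n)
partitions-unique n = unique n n n

∈-partitionsAvoiding : ∀ k n {p} → p ∈ partitionsAvoiding k n ⇔ (IsPartition n p × k ∉ p)
∈-partitionsAvoiding k n = mk⇔
  (λ p∈ → let p∈′ , k∉p = ∈-filter⁻ (k ∉?_) {xs = partitions n} p∈
          in Equivalence.to (∈-partitions n) p∈′ , k∉p)
  (λ (isP , k∉p) → ∈-filter⁺ (k ∉?_) (Equivalence.from (∈-partitions n) isP) k∉p)

partitionsAvoiding-unique : ∀ k n → Unique (partitionsAvoiding k n)
partitionsAvoiding-unique k n = Unique.filter⁺ (k ∉?_) (partitions-unique n)

{-# OPTIONS --safe #-}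

-- Let E = ∏ (1 - qⁱ), let p be 5, 7 or 11, and let V be the generating function of ν p, so that
-- E V = 1 - q^p. Modulo p, E^p = ∏ (1 - q^(pi)) is a power series in q^p, as is E V. For a suitable j
-- we have p j = 3 k + 1, and E^(pj) V = (E V) (E³)ᵏ shows that V has no exponents in a class r mod p
-- as soon as (E³)ᵏ has none. By Jacobi, E³ = Σ (-1)ⁱ (2i+1) q^(i(i+1)/2), so the exponents of E³
-- lie modulo p in {0,1}, {0,1,3} and {0,1,3,6,10} respectively. For p = 5 and p = 7 no sum of k
-- (3 and 2, respectively) of these residues equals r (4 and 5). For p = 11, k = 7 and r = 6, Euler's
-- pentagonal number theorem shows that (E³)⁴ = E¹¹ E has no exponents congruent to 3, 6, 8, 9 or 10,
-- and the part of (E³)⁷ in class 6 is a combination of the vanishing parts of (E³)⁴.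
--
-- For the coefficient of qᴺ all series can be read modulo q^(N+1), which makes the products finite.

module Submission where

open import Defs
open import Algebra using (CommutativeRing)
open import Algebra.Solver.Ring.AlmostCommutativeRing using (_-Raw-AlmostCommutative⟶_; fromCommutativeRing)
open import Data.Empty using (⊥-elim)
open import Data.Fin using (Fin; zero; suc)
open import Data.Fin.Patterns
open import Data.Integer as ℤ using (ℤ; +_)
import Data.Integer.Divisibility.Signed as ℤ
import Data.Integer.Properties as ℤ
open import Data.Integer.Tactic.RingSolver using (solve-∀)
open import Data.Nat as ℕ using (ℕ; zero; suc; s≤s)
import Data.Nat.DivMod as ℕ
import Data.Nat.Divisibility as ℕ
import Data.Nat.Properties as ℕ
open import Data.Nat.Tactic.RingSolver using () renaming (solve-∀ to ℕ-solve-∀)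
open import Data.List using (List; []; _∷_; _++_; map; filter; length)
open import Data.List.Membership.DecPropositional ℕ._≟_ using (_∉?_)
open import Data.List.Membership.Propositional using (_∉_)
open import Data.List.Properties using (filter-++; length-++; filter-accept; filter-reject; filter-none)
import Data.List.Relation.Unary.All as List
import Data.List.Relation.Unary.All.Properties as List
open import Data.List.Relation.Unary.Any using (here; there)
open import Data.Maybe using (Maybe; just; nothing)
open import Data.Product using (_×_; _,_; proj₁; proj₂)
open import Data.Sum as Sum using (_⊎_; inj₁; inj₂)
open import Data.Vec as Vec using (Vec; []; _∷_; lookup)
open import Data.Vec.Properties using (lookup-map)
open import Data.Vec.Relation.Unary.All using (All; []; _∷_)
open import Data.Vec.Relation.Unary.AllPairs using (AllPairs; []; _∷_; allPairs?)
open import Data.Vec.Relation.Unary.Any as Any using (Any; here; there; any?)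
open import Function using (_∘_)
open import Level using (0ℓ)
open import Relation.Binary.PropositionalEquality as ≡ using (_≡_; _≢_; _≗_)
open import Relation.Nullary using (¬_; Dec; yes; no; map′; ¬?; _×-dec_; _⊎-dec_)
open import Relation.Nullary.Decidable using (from-yes; from-no)

-- The residue classes become transparent through 8 i(i+1)/2 + 1 = (2i+1)². Modulo p the terms of E³
-- with 2i+1 divisible by p disappear, so every surviving exponent e has 8e+1 a nonzero square, and
-- class r of (E³)ᵏ collects the k-tuples of nonzero squares with sum 8r+k. In all three cases 8r+k
-- is 0 modulo p. For p = 5 the nonzero squares are 1 and -1, and three of these cannot sum to 0;
-- for p = 7 two of them cannot, since -1 is not a square. For p = 11 the argument breaks down:
-- seven nonzero squares can sum to 0 (1+1+9+1+1+4+5 = 22), so the vanishing there needs relations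
-- between the parts of E³, which Euler's theorem supplies.
--
-- Passing from E^(pj) V to V requires E to be a unit. Its inverse is not constructed algebraically:
-- it is the generating function of all partitions, obtained as the count of partitions avoiding the
-- impossible part 0. What remains for each prime is a finite polynomial identity in the parts of
-- E³, the same for every n.

-- Polynomial identities with coefficients modulo p

ℤ-Constants : CommutativeRing 0ℓ 0ℓ → Set
ℤ-Constants R = CommutativeRing.rawRing ℤ.+-*-commutativeRing -Raw-AlmostCommutative⟶ fromCommutativeRing R

Multiples≈0 : ℕ → (R : CommutativeRing 0ℓ 0ℓ) → ℤ-Constants R → Set
Multiples≈0 p R constants = ∀ c → + p ℤ.∣ c → ⟦ c ⟧ ≈ 0#
  where
  open CommutativeRing R
  open _-Raw-AlmostCommutative⟶_ constants

module Characteristic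
  (p : ℕ) (R : CommutativeRing 0ℓ 0ℓ)
  (constants : ℤ-Constants R)
  (p≈0 : Multiples≈0 p R constants)
  where

  open CommutativeRing R hiding (zero)
  open _-Raw-AlmostCommutative⟶_ constants renaming (⟦_⟧ to κ)
  open import Algebra.Properties.Group +-group using (x∙y⁻¹≈ε⇒x≈y)

  κ-cong : ∀ c d → + p ℤ.∣ c ℤ.- d → κ c ≈ κ d
  κ-cong c d p∣c-d = x∙y⁻¹≈ε⇒x≈y _ _
    (trans (+-congˡ (sym (-‿homo d))) (trans (sym (+-homo c (ℤ.- d))) (p≈0 _ p∣c-d)))

  -- Coefficients are compared modulo p, so the solver discards those divisible by p. It does not reduce
  -- the others, so an identity that holds only in characteristic p has to be stated as x - y ≈ 0.
  congruent? : ∀ c d → Maybe (κ c ≈ κ d)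
  congruent? c d with + p ℤ.∣? (c ℤ.- d)
  ... | yes p∣c-d = just (κ-cong c d p∣c-d)
  ... | no  _     = nothing

  import Algebra.Solver.Ring
    (CommutativeRing.rawRing ℤ.+-*-commutativeRing) (fromCommutativeRing R) constants congruent? as Solver
  open Solver public using (⟦_⟧; Polynomial; con; var; _:+_; _:*_; _:-_; :-_; _:^_; _:=_; solve; prove; Env)

  Σ-poly : ∀ {m n} → (Fin m → Polynomial n) → Polynomial n
  Σ-poly {zero}  f = con (+ 0)
  Σ-poly {suc m} f = f zero :+ Σ-poly (λ i → f (suc i))

  δ : ∀ {n} → ℤ → Polynomial n
  δ r with + p ℤ.∣? r
  ... | yes _ = con (+ 1)
  ... | no  _ = con (+ 0)

  ⟦δ⟧-∣ : ∀ {n r} → + p ℤ.∣ r → (ρ : Env n) → ⟦ δ r ⟧ ρ ≡ κ (+ 1)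
  ⟦δ⟧-∣ {r = r} p∣r ρ with + p ℤ.∣? r
  ... | yes _   = ≡.refl
  ... | no  p∤r = ⊥-elim (p∤r p∣r)

  ⟦δ⟧-∤ : ∀ {n r} → ¬ + p ℤ.∣ r → (ρ : Env n) → ⟦ δ r ⟧ ρ ≡ κ (+ 0)
  ⟦δ⟧-∤ {r = r} p∤r ρ with + p ℤ.∣? r
  ... | yes p∣r = ⊥-elim (p∤r p∣r)
  ... | no  _   = ≡.refl

  -- If the i-th variable has weight lookup w i in ℤ/p, this is the part of weight r
  -- of the k-th power of the sum of all variables.
  power-component : ∀ {m} → Vec ℤ m → ℕ → ℤ → Polynomial m
  power-component w zero    r = δ r
  power-component w (suc k) r = Σ-poly λ i → var i :* power-component w k (r ℤ.- lookup w i)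

-- The theorems of Euler and Jacobi modulo q^(N+1)

module EulerProducts
  (R : CommutativeRing 0ℓ 0ℓ)
  (constants : ℤ-Constants R)
  where

  open CommutativeRing R hiding (zero)
  open _-Raw-AlmostCommutative⟶_ constants renaming (⟦_⟧ to κ)
  open import Algebra.Properties.CommutativeSemiring.Exp commutativeSemiring
  open import Algebra.Properties.Ring ring using (-0#≈0#)
  open import Relation.Binary.Reasoning.Setoid setoid

  -- Only 0 is a multiple of 0, so this instance of the solver compares integer coefficients exactly
  -- and is valid in every commutative ring.
  open Characteristic 0 R constants
    (λ c 0∣c → trans (reflexive (≡.cong κ (ℤ.0∣⇒≡0 0∣c))) 0-homo)
    using (Polynomial; con; _:+_; _:*_; _:-_; :-_; _:^_; _:=_; solve)

  -- con (+ 1) evaluates to κ (+ 1), but x :^ 0 to 1# itself.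
  :1 : ∀ {n} → Polynomial n
  :1 = con (+ 1) :^ 0

  x-0*y≈x : ∀ x y → x - 0# * y ≈ x
  x-0*y≈x x y = begin
    x - 0# * y  ≈⟨ +-congˡ (-‿cong (zeroˡ y)) ⟩
    x - 0#      ≈⟨ +-congˡ -0#≈0# ⟩
    x + 0#      ≈⟨ +-identityʳ x ⟩
    x           ∎

  [1-x]y≈z : ∀ {x y z} → y ≈ z + x * y → (1# - x) * y ≈ z
  [1-x]y≈z {x} {y} {z} y≈z+xy = begin
    (1# - x) * y      ≈⟨ solve 2 (λ x y → (:1 :- x) :* y := y :- x :* y) refl x y ⟩
    y - x * y         ≈⟨ +-congʳ y≈z+xy ⟩
    z + x * y - x * y ≈⟨ solve 3 (λ x y z → z :+ x :* y :- x :* y := z) refl x y z ⟩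
    z                 ∎

  Σ< : ℕ → (ℕ → Carrier) → Carrier
  Σ< zero    f = 0#
  Σ< (suc m) f = Σ< m f + f m

  Σ<-cong : ∀ m {f g} → (∀ {k} → k ℕ.< m → f k ≈ g k) → Σ< m f ≈ Σ< m g
  Σ<-cong zero    f≈g = refl
  Σ<-cong (suc m) f≈g = +-cong (Σ<-cong m (λ k<m → f≈g (ℕ.m≤n⇒m≤1+n k<m))) (f≈g ℕ.≤-refl)

  *-distribˡ-Σ< : ∀ m x f → x * Σ< m f ≈ Σ< m (λ k → x * f k)
  *-distribˡ-Σ< zero    x f = zeroʳ x
  *-distribˡ-Σ< (suc m) x f = trans (distribˡ x _ _) (+-congʳ (*-distribˡ-Σ< m x f))

  odd : ℕ → Carrier
  odd k = κ (+ suc (2 ℕ.* k))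

  odd-suc : ∀ k → odd (suc k) ≈ odd k + κ (+ 2)
  odd-suc k = trans (reflexive (≡.cong (λ m → κ (+ suc m)) (≡.trans (ℕ.*-suc 2 k) (ℕ.+-comm 2 (2 ℕ.* k)))))
                    (+-homo (+ suc (2 ℕ.* k)) (+ 2))

  -- `P⁻¹ b` plays the role of the generating function of partitions into parts at most b. Its two
  -- recurrences are all that is needed to make each finite product `P b` a unit, hence cancellable
  -- in a ring with zero divisors such as this one, where q is nilpotent.
  module Products
    (q : Carrier) (N : ℕ) (q^1+N≈0 : q ^ suc N ≈ 0#)
    (P⁻¹ : ℕ → Carrier) (P⁻¹-zero : P⁻¹ 0 ≈ 1#)
    (P⁻¹-suc : ∀ b → (1# - q ^ suc b) * P⁻¹ (suc b) ≈ P⁻¹ b)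
    where

    P : ℕ → Carrier
    P zero    = 1#
    P (suc n) = P n * (1# - q ^ suc n)

    -- (-1)ᵏ q^(k(k+1)/2)
    t : ℕ → Carrier
    t zero    = 1#
    t (suc k) = - (q ^ suc k * t k)

    P-inverse : ∀ n → P n * P⁻¹ n ≈ 1#
    P-inverse zero    = trans (*-identityˡ _) P⁻¹-zero
    P-inverse (suc n) = begin
      P n * (1# - q ^ suc n) * P⁻¹ (suc n)   ≈⟨ *-assoc _ _ _ ⟩
      P n * ((1# - q ^ suc n) * P⁻¹ (suc n)) ≈⟨ *-congˡ (P⁻¹-suc n) ⟩
      P n * P⁻¹ n                            ≈⟨ P-inverse n ⟩
      1#                                     ∎

    P-cancelˡ : ∀ n {x y} → P n * x ≈ P n * y → x ≈ y
    P-cancelˡ n {x} {y} Px≈Py = begin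
      x                   ≈⟨ trans (*-congʳ (P-inverse n)) (*-identityˡ x) ⟨
      P n * P⁻¹ n * x     ≈⟨ solve 3 (λ a b x → a :* b :* x := b :* (a :* x)) refl _ _ _ ⟩
      P⁻¹ n * (P n * x)   ≈⟨ *-congˡ Px≈Py ⟩
      P⁻¹ n * (P n * y)   ≈⟨ solve 3 (λ a b x → b :* (a :* x) := a :* b :* x) refl _ _ _ ⟩
      P n * P⁻¹ n * y     ≈⟨ trans (*-congʳ (P-inverse n)) (*-identityˡ y) ⟩
      y                   ∎

    P^-cancel : ∀ n j {x} → P n ^ j * x ≈ 0# → x ≈ 0#
    P^-cancel n zero    1x≈0 = trans (sym (*-identityˡ _)) 1x≈0
    P^-cancel n (suc j) Px≈0 =
      P^-cancel n j (P-cancelˡ n (trans (sym (*-assoc _ _ _)) (trans Px≈0 (sym (zeroʳ _)))))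

    q^≈0 : ∀ {m} → N ℕ.< m → q ^ m ≈ 0#
    q^≈0 {m} N<m = begin
      q ^ m                         ≈⟨ ^-congʳ q (ℕ.m+[n∸m]≡n N<m) ⟨
      q ^ (suc N ℕ.+ (m ℕ.∸ suc N)) ≈⟨ ^-homo-* q (suc N) _ ⟩
      q ^ suc N * _                 ≈⟨ *-congʳ q^1+N≈0 ⟩
      0# * _                        ≈⟨ zeroˡ _ ⟩
      0#                            ∎

    -- A factor of index m > j differs from 1 by q^m, and q^k q^m = 0 because k + m exceeds N.
    q^k*P-stable : ∀ k j → N ℕ.≤ k ℕ.+ j → ∀ i → q ^ k * P (i ℕ.+ j) ≈ q ^ k * P j
    q^k*P-stable k j N≤k+j zero    = refl
    q^k*P-stable k j N≤k+j (suc i) = begin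
      q ^ k * (P (i ℕ.+ j) * (1# - q ^ suc (i ℕ.+ j)))
        ≈⟨ solve 3 (λ a b c → a :* (b :* (:1 :- c)) := a :* b :- (a :* c) :* b) refl _ _ _ ⟩
      q ^ k * P (i ℕ.+ j) - (q ^ k * q ^ suc (i ℕ.+ j)) * P (i ℕ.+ j)
        ≈⟨ +-congˡ (-‿cong (*-congʳ (trans (sym (^-homo-* q k _)) (q^≈0 N<)))) ⟩
      q ^ k * P (i ℕ.+ j) - 0# * P (i ℕ.+ j)
        ≈⟨ x-0*y≈x _ _ ⟩
      q ^ k * P (i ℕ.+ j)
        ≈⟨ q^k*P-stable k j N≤k+j i ⟩
      q ^ k * P j ∎
      where
      N< : N ℕ.< k ℕ.+ suc (i ℕ.+ j)
      N< = ℕ.≤-trans (s≤s (ℕ.≤-trans N≤k+j (ℕ.+-monoʳ-≤ k (ℕ.m≤n+m j i))))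
        (ℕ.≤-reflexive (≡.sym (ℕ.+-suc k _)))

    P-stable : ∀ m → N ℕ.≤ m → P m ≈ P N
    P-stable m N≤m = begin
      P m                     ≈⟨ *-identityˡ _ ⟨
      1# * P m                ≡⟨ ≡.cong (λ i → 1# * P i) (ℕ.m∸n+n≡m N≤m) ⟨
      1# * P (m ℕ.∸ N ℕ.+ N)  ≈⟨ q^k*P-stable 0 N ℕ.≤-refl (m ℕ.∸ N) ⟩
      1# * P N                ≈⟨ *-identityˡ _ ⟩
      P N                     ∎

    -- `t k` is divisible by q^k, so it cannot see the factors of index above N - k.
    t*P-stable : ∀ k j → k ℕ.+ j ≡ N → t k * P N ≈ t k * P j
    t*P-stable zero    j ≡.refl = refl
    t*P-stable (suc k) j ≡.refl = begin
      - (q ^ suc k * t k) * P N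
        ≈⟨ solve 3 (λ a b c → (:- (a :* b)) :* c := (:- b) :* (a :* c)) refl _ _ _ ⟩
      - t k * (q ^ suc k * P N)
        ≈⟨ *-congˡ (q^k*P-stable (suc k) j ℕ.≤-refl (suc k)) ⟩
      - t k * (q ^ suc k * P j)
        ≈⟨ solve 3 (λ a b c → (:- b) :* (a :* c) := (:- (a :* b)) :* c) refl _ _ _ ⟩
      - (q ^ suc k * t k) * P j ∎

    -- Shanks: passing from n to n + 1, the sum over s ≤ n of these terms telescopes.

    shanksTerm : ℕ → ℕ → Carrier
    shanksTerm n s = P n * (P⁻¹ s * t s) * (q ^ n) ^ s

    -- With m = n + 1, the step adds the exponents m(3m+1)/2 and m(3m-1)/2, both with sign (-1)^m
    -- since `t n` and `t (suc n)` have opposite signs: these are the generalised pentagonal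
    -- numbers.
    pentagonal : ℕ → Carrier
    pentagonal zero    = 1#
    pentagonal (suc n) = pentagonal n + (t (suc n) - t n) * q ^ (suc n ℕ.* suc n)

    -- Passing from n to n + 1 multiplies term s by (1 - q^(n+1)) q^s, and (1 - q^(n+1)) q^s - 1 =
    -- -(1 - q^s) - q^(n+1+s). By the recurrences of `P⁻¹` and `t`, the first summand cancels the
    -- defect left at s - 1; the second is the defect at s.
    shanks-telescope : ∀ n m →
      Σ< (suc m) (shanksTerm (suc n)) ≈
      Σ< (suc m) (shanksTerm n) - P n * (P⁻¹ m * t m) * (q ^ n) ^ m * (q * q ^ n) * q ^ m
    shanks-telescope n zero =
      solve 4 (λ z p c y →
        z :+ (p :* (:1 :- y)) :* (c :* :1) :* :1 :=
        z :+ p :* (c :* :1) :* :1 :- p :* (c :* :1) :* :1 :* y :* :1) refl _ _ _ _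
    shanks-telescope n (suc m) = begin
      Σ< (suc m) (shanksTerm (suc n)) + P (suc n) * (c * t (suc m)) * ((q * x) * (q ^ suc n) ^ m)
        ≈⟨ +-cong (shanks-telescope n m) (*-congˡ (*-congˡ (trans (^-distrib-* q x m) refl))) ⟩
      S - P n * (P⁻¹ m * t m) * X * (q * x) * y + P (suc n) * (c * t (suc m)) * ((q * x) * (y * X))
        ≈⟨ +-congʳ (+-congˡ (-‿cong (*-congʳ (*-congʳ (*-congʳ (*-congˡ (*-congʳ (P⁻¹-suc m)))))))) ⟨
      S - P n * (((1# - q * y) * c) * t m) * X * (q * x) * y + P (suc n) * (c * t (suc m)) * ((q * x) * (y * X))
        ≈⟨ solve 8 (λ s p q y c τ X x →
             s :- p :* (((:1 :- q :* y) :* c) :* τ) :* X :* (q :* x) :* y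
               :+ (p :* (:1 :- q :* x)) :* (c :* :- (q :* y :* τ)) :* ((q :* x) :* (y :* X)) :=
             s :+ p :* (c :* :- (q :* y :* τ)) :* (x :* X)
               :- p :* (c :* :- (q :* y :* τ)) :* (x :* X) :* (q :* x) :* (q :* y))
             refl _ _ _ _ _ _ _ _ ⟩
      S + P n * (c * t (suc m)) * (x * X) - P n * (c * t (suc m)) * (x * X) * (q * x) * (q * y) ∎
      where
      x y X c S : Carrier
      x = q ^ n
      y = q ^ m
      X = x ^ m
      c = P⁻¹ (suc m)
      S = Σ< (suc m) (shanksTerm n)

    -- Two contributions arise at n + 1: the telescoped defect at s = n and the new term s = n + 1.
    -- In each, `P` meets `P⁻¹` of the same index and cancels, and both carry the power q^((n+1)²).
    shanks : ∀ n → Σ< (suc n) (shanksTerm n) ≈ pentagonal n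
    shanks zero = begin
      0# + 1# * (P⁻¹ 0 * 1#) * 1#  ≈⟨ +-identityˡ _ ⟩
      1# * (P⁻¹ 0 * 1#) * 1#       ≈⟨ solve 1 (λ c → :1 :* (c :* :1) :* :1 := c) refl _ ⟩
      P⁻¹ 0                        ≈⟨ P⁻¹-zero ⟩
      1#                           ∎
    shanks (suc n) = begin
      Σ< (suc n) (shanksTerm (suc n)) + P (suc n) * (P⁻¹ (suc n) * t (suc n)) * (q ^ suc n) ^ suc n
        ≈⟨ +-cong (shanks-telescope n n) (*-congˡ (*-congˡ (^-distrib-* q x n))) ⟩
      S - P n * (P⁻¹ n * t n) * X * (q * x) * x + P (suc n) * (P⁻¹ (suc n) * t (suc n)) * ((q * x) * (x * X))
        ≈⟨ solve 10 (λ s p c τ X y x p′ c′ τ′ →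
             s :- p :* (c :* τ) :* X :* y :* x :+ p′ :* (c′ :* τ′) :* (y :* (x :* X)) :=
             s :+ ((p′ :* c′) :* τ′ :- (p :* c) :* τ) :* (y :* (x :* X)))
             refl _ _ _ _ _ _ _ _ _ _ ⟩
      S + ((P (suc n) * P⁻¹ (suc n)) * t (suc n) - (P n * P⁻¹ n) * t n) * ((q * x) * (x * X))
        ≈⟨ +-cong (shanks n) (*-cong (+-cong (*-congʳ (P-inverse (suc n))) (-‿cong (*-congʳ (P-inverse n))))
             (*-congˡ (sym (^-distrib-* q x n)))) ⟩
      pentagonal n + (1# * t (suc n) - 1# * t n) * (q ^ suc n) ^ suc n
        ≈⟨ +-congˡ (*-cong (+-cong (*-identityˡ _) (-‿cong (*-identityˡ _))) (^-assocʳ q (suc n) (suc n))) ⟩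
      pentagonal n + (t (suc n) - t n) * q ^ (suc n ℕ.* suc n) ∎
      where
      x X S : Carrier
      x = q ^ n
      X = x ^ n
      S = Σ< (suc n) (shanksTerm n)

    -- For s > 0 the term contains q^N from the power and at least one more q from `t s`, hence
    -- vanishes; only s = 0 survives.
    Σ-shanksTerm-N : ∀ m → Σ< (suc m) (shanksTerm N) ≈ P N
    Σ-shanksTerm-N zero = begin
      0# + P N * (P⁻¹ 0 * 1#) * 1#  ≈⟨ +-identityˡ _ ⟩
      P N * (P⁻¹ 0 * 1#) * 1#       ≈⟨ solve 2 (λ p c → p :* (c :* :1) :* :1 := p :* c) refl _ _ ⟩
      P N * P⁻¹ 0                   ≈⟨ *-congˡ P⁻¹-zero ⟩
      P N * 1#                      ≈⟨ *-identityʳ _ ⟩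
      P N                           ∎
    Σ-shanksTerm-N (suc m) = begin
      Σ< (suc m) (shanksTerm N) + P N * (P⁻¹ (suc m) * - (q * q ^ m * t m)) * (q ^ N * (q ^ N) ^ m)
        ≈⟨ +-cong (Σ-shanksTerm-N m)
             (solve 7 (λ p c q y τ x X → p :* (c :* :- (q :* y :* τ)) :* (x :* X) :=
                :- ((q :* x) :* (p :* c :* y :* τ :* X))) refl _ _ _ _ _ _ _) ⟩
      P N - (q * q ^ N) * _
        ≈⟨ +-congˡ (-‿cong (*-congʳ q^1+N≈0)) ⟩
      P N - 0# * _
        ≈⟨ x-0*y≈x _ _ ⟩
      P N ∎

    P≈pentagonal : P N ≈ pentagonal N
    P≈pentagonal = trans (sym (Σ-shanksTerm-N N)) (shanks N)

    -- d n k is the coefficient of z⁻ᵏ in (1 - z) ∏_{1≤i≤n} (1 - z qⁱ)(1 - z⁻¹ qⁱ). That of zᵏ⁺¹ is its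
    -- opposite, which accounts for the case k = 0. Dividing by 1 - z and setting z = 1 turns
    -- the product into Σ (2k+1) d n k = (P n)², the finite form of Jacobi's identity.
    d : ℕ → ℕ → Carrier
    d zero    zero    = 1#
    d zero    (suc k) = 0#
    d (suc n) zero    = (1# + q ^ suc n * q ^ suc n) * d n 0 - q ^ suc n * (d n 1 - d n 0)
    d (suc n) (suc k) = (1# + q ^ suc n * q ^ suc n) * d n (suc k) - q ^ suc n * (d n k + d n (suc (suc k)))

    n<k⇒d≈0 : ∀ {n k} → n ℕ.< k → d n k ≈ 0#
    n<k⇒d≈0 {zero}  {suc k} _         = refl
    n<k⇒d≈0 {suc n} {suc k} (s≤s n<k) = begin
      (1# + x * x) * d n (suc k) - x * (d n k + d n (suc (suc k)))
        ≈⟨ +-cong (*-congˡ (n<k⇒d≈0 (ℕ.m≤n⇒m≤1+n n<k)))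
             (-‿cong (*-congˡ (+-cong (n<k⇒d≈0 n<k) (n<k⇒d≈0 (ℕ.m≤n⇒m≤1+n (ℕ.m≤n⇒m≤1+n n<k)))))) ⟩
      (1# + x * x) * 0# - x * (0# + 0#)
        ≈⟨ solve 2 (λ x z → (:1 :+ x :* x) :* z :- x :* (z :+ z) := z :* (:1 :+ x :* x :- x :- x)) refl x 0# ⟩
      0# * _
        ≈⟨ zeroˡ _ ⟩
      0# ∎
      where
      x : Carrier
      x = q ^ suc n

    -- The weights are linear in k, so the neighbours of `odd k` add up to twice `odd k`. Moving the
    -- two index shifts of the recursion onto the weights gives 1 + x² - 2x = (1 - x)², up to the
    -- boundary term from cutting the sum at m. At k = 0 the missing weight is -1, matching the
    -- antisymmetry of the coefficients.
    Σ-odd*d-suc : ∀ m n →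
      Σ< (suc m) (λ k → odd k * d (suc n) k) ≈
      (1# - q ^ suc n) * (1# - q ^ suc n) * Σ< (suc m) (λ k → odd k * d n k)
        - q ^ suc n * (odd m * d n (suc m) - odd (suc m) * d n m)
    Σ-odd*d-suc zero n = begin
      0# + odd 0 * ((1# + x * x) * d n 0 - x * (d n 1 - d n 0))
        ≈⟨ +-congʳ (zeroʳ _) ⟨
      (1# - x) * (1# - x) * 0# + odd 0 * ((1# + x * x) * d n 0 - x * (d n 1 - d n 0))
        ≈⟨ solve 4 (λ x z d₀ d₁ →
             (:1 :- x) :* (:1 :- x) :* z :+ con (+ 1) :* ((:1 :+ x :* x) :* d₀ :- x :* (d₁ :- d₀)) :=
             (:1 :- x) :* (:1 :- x) :* (z :+ con (+ 1) :* d₀) :- x :* (con (+ 1) :* d₁ :- con (+ 3) :* d₀))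
             refl _ _ _ _ ⟩
      (1# - x) * (1# - x) * (0# + odd 0 * d n 0) - x * (odd 0 * d n 1 - odd 1 * d n 0) ∎
      where
      x : Carrier
      x = q ^ suc n
    Σ-odd*d-suc (suc m) n = begin
      Σ< (suc m) (λ k → odd k * d (suc n) k) + odd (suc m) * ((1# + x * x) * d₁ - x * (d₀ + d₂))
        ≈⟨ +-cong (Σ-odd*d-suc m n) (*-congʳ (odd-suc m)) ⟩
      (1# - x) * (1# - x) * S - x * (odd m * d₁ - odd (suc m) * d₀)
        + (odd m + κ (+ 2)) * ((1# + x * x) * d₁ - x * (d₀ + d₂))
        ≈⟨ +-congʳ (+-congˡ (-‿cong (*-congˡ (+-congˡ (-‿cong (*-congʳ (odd-suc m))))))) ⟩
      (1# - x) * (1# - x) * S - x * (odd m * d₁ - (odd m + κ (+ 2)) * d₀)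
        + (odd m + κ (+ 2)) * ((1# + x * x) * d₁ - x * (d₀ + d₂))
        ≈⟨ solve 6 (λ x s o d₀ d₁ d₂ →
             (:1 :- x) :* (:1 :- x) :* s :- x :* (o :* d₁ :- (o :+ con (+ 2)) :* d₀)
               :+ (o :+ con (+ 2)) :* ((:1 :+ x :* x) :* d₁ :- x :* (d₀ :+ d₂)) :=
             (:1 :- x) :* (:1 :- x) :* (s :+ (o :+ con (+ 2)) :* d₁)
               :- x :* ((o :+ con (+ 2)) :* d₂ :- (o :+ con (+ 2) :+ con (+ 2)) :* d₁)) refl _ _ _ _ _ _ ⟩
      (1# - x) * (1# - x) * (S + (odd m + κ (+ 2)) * d₁)
        - x * ((odd m + κ (+ 2)) * d₂ - (odd m + κ (+ 2) + κ (+ 2)) * d₁)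
        ≈⟨ +-cong (*-congˡ (+-congˡ (*-congʳ (odd-suc m))))
             (-‿cong (*-congˡ (+-cong (*-congʳ (odd-suc m))
               (-‿cong (*-congʳ (trans (odd-suc (suc m)) (+-congʳ (odd-suc m)))))))) ⟨
      (1# - x) * (1# - x) * (S + odd (suc m) * d₁) - x * (odd (suc m) * d₂ - odd (suc (suc m)) * d₁) ∎
      where
      x d₀ d₁ d₂ S : Carrier
      x = q ^ suc n
      d₀ = d n m
      d₁ = d n (suc m)
      d₂ = d n (suc (suc m))
      S = Σ< (suc m) (λ k → odd k * d n k)

    Σ-odd*d-zero : ∀ m → Σ< (suc m) (λ k → odd k * d 0 k) ≈ 1#
    Σ-odd*d-zero zero    = trans (+-identityˡ _) (trans (*-identityʳ _) 1-homo)
    Σ-odd*d-zero (suc m) = trans (+-cong (Σ-odd*d-zero m) (zeroʳ _)) (+-identityʳ _)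

    -- As long as n ≤ m, the boundary terms of each step involve only coefficients beyond the degree
    -- of the product, which are 0.
    Σ-odd*d : ∀ {m n} → n ℕ.≤ m → Σ< (suc m) (λ k → odd k * d n k) ≈ P n * P n
    Σ-odd*d {m} {zero}  _   = trans (Σ-odd*d-zero m) (sym (*-identityˡ 1#))
    Σ-odd*d {m} {suc n} n<m = begin
      Σ< (suc m) (λ k → odd k * d (suc n) k)
        ≈⟨ Σ-odd*d-suc m n ⟩
      (1# - x) * (1# - x) * Σ< (suc m) (λ k → odd k * d n k) - x * (odd m * d n (suc m) - odd (suc m) * d n m)
        ≈⟨ +-cong (*-congˡ (Σ-odd*d (ℕ.<⇒≤ n<m)))
             (-‿cong (*-congˡ (+-cong (*-congˡ (n<k⇒d≈0 (ℕ.m≤n⇒m≤1+n n<m))) (-‿cong (*-congˡ (n<k⇒d≈0 n<m)))))) ⟩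
      (1# - x) * (1# - x) * (P n * P n) - x * (odd m * 0# - odd (suc m) * 0#)
        ≈⟨ solve 5 (λ x p a b z →
             (:1 :- x) :* (:1 :- x) :* (p :* p) :- x :* (a :* z :- b :* z) :=
             (p :* (:1 :- x)) :* (p :* (:1 :- x)) :- z :* (x :* (a :- b))) refl _ _ _ _ _ ⟩
      P (suc n) * P (suc n) - 0# * _
        ≈⟨ x-0*y≈x _ _ ⟩
      P (suc n) * P (suc n) ∎
      where
      x : Carrier
      x = q ^ suc n

    -- This is the finite Jacobi triple product: `d n k` is `t k` times the Gaussian binomial
    -- coefficient of 2n+1 over n-k. Its denominators are cleared, and j stands for n - k to avoid
    -- subtraction.
    d-closed : ∀ n k j → k ℕ.+ j ≡ n → P j * P (suc (k ℕ.+ n)) * d n k ≈ t k * P (suc (n ℕ.+ n))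

    -- The closed form at k + 1, multiplied by 1 - q^j so that it also covers j = 0, where k + 1
    -- exceeds n and both sides vanish. The recursion for `d` looks one index beyond k, and this
    -- saves a separate case there.
    d-closed-suc : ∀ n k j → k ℕ.+ j ≡ n →
      P j * P (suc (suc (k ℕ.+ n))) * d n (suc k) ≈ (1# - q ^ j) * (t (suc k) * P (suc (n ℕ.+ n)))
    d-closed-suc n k zero k+0≡n = begin
      P 0 * P (suc (suc (k ℕ.+ n))) * d n (suc k)
        ≈⟨ *-congˡ (n<k⇒d≈0 (s≤s (ℕ.≤-reflexive (≡.trans (≡.sym k+0≡n) (ℕ.+-identityʳ k))))) ⟩
      P 0 * P (suc (suc (k ℕ.+ n))) * 0#           ≈⟨ zeroʳ _ ⟩
      0#                                           ≈⟨ zeroˡ _ ⟨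
      0# * (t (suc k) * P (suc (n ℕ.+ n)))         ≈⟨ *-congʳ (-‿inverseʳ 1#) ⟨
      (1# - 1#) * (t (suc k) * P (suc (n ℕ.+ n)))  ∎
    d-closed-suc n k (suc j) k+j≡n = begin
      P j * (1# - q ^ suc j) * P (suc (suc (k ℕ.+ n))) * d n (suc k)
        ≈⟨ solve 4 (λ a b c d → a :* b :* c :* d := b :* (a :* c :* d)) refl _ _ _ _ ⟩
      (1# - q ^ suc j) * (P j * P (suc (suc k ℕ.+ n)) * d n (suc k))
        ≈⟨ *-congˡ (d-closed n (suc k) j (≡.trans (≡.sym (ℕ.+-suc k j)) k+j≡n)) ⟩
      (1# - q ^ suc j) * (t (suc k) * P (suc (n ℕ.+ n))) ∎

    P-odd-step : ∀ n → P (suc (suc n ℕ.+ suc n)) ≈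
      P (suc (n ℕ.+ n)) * (1# - (q * q ^ n) * (q * q ^ n)) * (1# - q * ((q * q ^ n) * (q * q ^ n)))
    P-odd-step n = begin
      P (suc (suc n ℕ.+ suc n))
        ≡⟨ ≡.cong (λ m → P (suc (suc m))) (ℕ.+-suc n n) ⟩
      P (suc (n ℕ.+ n)) * (1# - q * (q * q ^ (n ℕ.+ n))) * (1# - q * (q * (q * q ^ (n ℕ.+ n))))
        ≈⟨ *-cong (*-congˡ (+-congˡ (-‿cong q²ⁿ))) (+-congˡ (-‿cong (*-congˡ q²ⁿ))) ⟩
      _ ∎
      where
      q²ⁿ : q * (q * q ^ (n ℕ.+ n)) ≈ (q * q ^ n) * (q * q ^ n)
      q²ⁿ = trans (*-congˡ (*-congˡ (^-homo-* q n n)))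
                  (solve 2 (λ q x → q :* (q :* (x :* x)) := (q :* x) :* (q :* x)) refl q (q ^ n))

    d-closed zero zero zero _ = solve 1 (λ x → :1 :* x :* :1 := :1 :* x) refl _
    d-closed (suc n) zero (suc .n) ≡.refl = begin
      P (suc n) * P (suc (suc n)) * d (suc n) 0
        ≈⟨ solve 5 (λ q x p d₀ d₁ →
             p :* (:1 :- q :* x) :* (p :* (:1 :- q :* x) :* (:1 :- q :* (q :* x)))
               :* ((:1 :+ (q :* x) :* (q :* x)) :* d₀ :- (q :* x) :* (d₁ :- d₀)) :=
             (:1 :- q :* x) :* (:1 :- q :* (q :* x)) :* (:1 :+ q :* x :+ (q :* x) :* (q :* x))
               :* (p :* (p :* (:1 :- q :* x)) :* d₀)
               :- (:1 :- q :* x) :* (q :* x) :* (p :* (p :* (:1 :- q :* x) :* (:1 :- q :* (q :* x))) :* d₁))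
             refl q (q ^ n) (P n) (d n 0) (d n 1) ⟩
      (1# - q * x) * (1# - q * (q * x)) * (1# + q * x + (q * x) * (q * x)) * (P n * P (suc n) * d n 0)
        - (1# - q * x) * (q * x) * (P n * P (suc (suc n)) * d n 1)
        ≈⟨ +-cong (*-congˡ (d-closed n 0 n ≡.refl)) (-‿cong (*-congˡ (d-closed-suc n 0 n ≡.refl))) ⟩
      (1# - q * x) * (1# - q * (q * x)) * (1# + q * x + (q * x) * (q * x)) * (1# * T)
        - (1# - q * x) * (q * x) * ((1# - x) * (- (q * 1# * 1#) * T))
        ≈⟨ solve 3 (λ q x T →
             (:1 :- q :* x) :* (:1 :- q :* (q :* x)) :* (:1 :+ q :* x :+ (q :* x) :* (q :* x)) :* (:1 :* T)
               :- (:1 :- q :* x) :* (q :* x) :* ((:1 :- x) :* ((:- (q :* :1 :* :1)) :* T)) :=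
             :1 :* (T :* (:1 :- (q :* x) :* (q :* x)) :* (:1 :- q :* ((q :* x) :* (q :* x))))) refl _ _ _ ⟩
      1# * (T * (1# - (q * x) * (q * x)) * (1# - q * ((q * x) * (q * x))))
        ≈⟨ *-congˡ (P-odd-step n) ⟨
      1# * P (suc (suc n ℕ.+ suc n)) ∎
      where
      x T : Carrier
      x = q ^ n
      T = P (suc (n ℕ.+ n))
    -- At the top index k = n only the lower neighbour `d n n` contributes; the other two
    -- coefficients lie beyond the degree.
    d-closed (suc n) (suc k) zero k+0≡n with ≡.trans (≡.sym (ℕ.+-identityʳ k)) (ℕ.suc-injective k+0≡n)
    ... | ≡.refl = begin
      P 0 * P (suc (suc n ℕ.+ suc n)) * ((1# + x * x) * d n (suc n) - x * (d n n + d n (suc (suc n))))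
        ≈⟨ *-cong (*-congˡ (P-odd-step n)) (+-cong (*-congˡ (n<k⇒d≈0 {n} ℕ.≤-refl))
             (-‿cong (*-congˡ (+-congˡ (n<k⇒d≈0 {n} (ℕ.m≤n⇒m≤1+n ℕ.≤-refl)))))) ⟩
      P 0 * (T * a * b) * ((1# + x * x) * 0# - x * (d n n + 0#))
        ≈⟨ *-congˡ (trans (+-congˡ (-‿cong (*-congˡ (+-identityʳ _)))) (trans (+-congʳ (zeroʳ _)) (+-identityˡ _))) ⟩
      P 0 * (T * a * b) * - (x * d n n)
        ≈⟨ solve 6 (λ p T a b x d → p :* (T :* a :* b) :* :- (x :* d) := (:- x) :* (p :* T :* d) :* a :* b)
             refl _ _ _ _ _ _ ⟩
      - x * (P 0 * T * d n n) * a * b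
        ≈⟨ *-congʳ (*-congʳ (*-congˡ (d-closed n n 0 (ℕ.+-identityʳ n)))) ⟩
      - x * (t n * T) * a * b
        ≈⟨ solve 5 (λ T a b x t → (:- x) :* (t :* T) :* a :* b := (:- (x :* t)) :* (T :* a :* b)) refl _ _ _ _ _ ⟩
      - (x * t n) * (T * a * b)
        ≈⟨ *-congˡ (P-odd-step n) ⟨
      - (x * t n) * P (suc (suc n ℕ.+ suc n)) ∎
      where
      x T a b : Carrier
      x = q ^ suc n
      T = P (suc (n ℕ.+ n))
      a = 1# - x * x
      b = 1# - q * (x * x)
    d-closed (suc n) (suc k) (suc j) k+j≡n = begin
      P (suc j) * P (suc (suc k ℕ.+ suc n)) * d (suc n) (suc k)
        ≡⟨ ≡.cong (λ m → P (suc j) * P (suc (suc m)) * d (suc n) (suc k)) (ℕ.+-suc k n) ⟩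
      P (suc j) * (P (suc (k ℕ.+ n)) * (1# - q * (q * q ^ (k ℕ.+ n))) * (1# - q * (q * (q * q ^ (k ℕ.+ n)))))
        * ((1# + (q * x) * (q * x)) * d n (suc k) - (q * x) * (d n k + d n (suc (suc k))))
        ≈⟨ solve 9 (λ q x y b V U d₀ d₁ d₂ →
             (V :* (:1 :- q :* b)) :* (U :* (:1 :- q :* (q :* y)) :* (:1 :- q :* (q :* (q :* y))))
               :* ((:1 :+ (q :* x) :* (q :* x)) :* d₁ :- (q :* x) :* (d₀ :+ d₂)) :=
             (:1 :- q :* b) :* (:1 :- q :* (q :* (q :* y))) :* (:1 :+ (q :* x) :* (q :* x))
               :* (V :* (U :* (:1 :- q :* (q :* y))) :* d₁)
             :- (q :* x) :* (:1 :- q :* (q :* y)) :* (:1 :- q :* (q :* (q :* y)))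
               :* ((V :* (:1 :- q :* b)) :* U :* d₀)
             :- (q :* x) :* (:1 :- q :* b)
               :* (V :* (U :* (:1 :- q :* (q :* y)) :* (:1 :- q :* (q :* (q :* y)))) :* d₂))
             refl q x (q ^ (k ℕ.+ n)) b (P j) (P (suc (k ℕ.+ n))) (d n k) (d n (suc k)) (d n (suc (suc k))) ⟩
      (1# - q * b) * (1# - q * (q * (q * q ^ (k ℕ.+ n)))) * (1# + (q * x) * (q * x))
        * (P j * P (suc (suc k ℕ.+ n)) * d n (suc k))
      - (q * x) * (1# - q * (q * q ^ (k ℕ.+ n))) * (1# - q * (q * (q * q ^ (k ℕ.+ n))))
        * (P (suc j) * P (suc (k ℕ.+ n)) * d n k)
      - (q * x) * (1# - q * b) * (P j * P (suc (suc (suc k ℕ.+ n))) * d n (suc (suc k)))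
        ≈⟨ +-cong (+-cong (*-congˡ (d-closed n (suc k) j 1+k+j≡n))
                          (-‿cong (*-congˡ (d-closed n k (suc j) (ℕ.suc-injective k+j≡n)))))
                  (-‿cong (*-congˡ (d-closed-suc n (suc k) j 1+k+j≡n))) ⟩
      (1# - q * b) * (1# - q * (q * (q * q ^ (k ℕ.+ n)))) * (1# + (q * x) * (q * x)) * (t (suc k) * T)
      - (q * x) * (1# - q * (q * q ^ (k ℕ.+ n))) * (1# - q * (q * (q * q ^ (k ℕ.+ n)))) * (t k * T)
      - (q * x) * (1# - q * b) * ((1# - b) * (t (suc (suc k)) * T))
        -- The solver would treat q^n and q^(k+n) as independent of q^k and q^j. The remaining
        -- identity needs n = k + 1 + j, so both are first rewritten as monomials in q, `a` and `b`.
        ≈⟨ +-cong (+-cong (*-congʳ (*-cong (*-congˡ (+-congˡ (-‿cong (*-congˡ (*-congˡ (*-congˡ y≈))))))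
                                           (+-congˡ (*-cong (*-congˡ x≈) (*-congˡ x≈)))))
                          (-‿cong (*-congʳ (*-cong (*-cong (*-congˡ x≈) (+-congˡ (-‿cong (*-congˡ (*-congˡ y≈)))))
                                                   (+-congˡ (-‿cong (*-congˡ (*-congˡ (*-congˡ y≈)))))))))
                  (-‿cong (*-congʳ (*-congʳ (*-congˡ x≈)))) ⟩
      (1# - q * b) * (1# - q * (q * (q * (a * (q * a * b))))) * (1# + (q * (q * a * b)) * (q * (q * a * b))) * (t (suc k) * T)
      - (q * (q * a * b)) * (1# - q * (q * (a * (q * a * b)))) * (1# - q * (q * (q * (a * (q * a * b))))) * (t k * T)
      - (q * (q * a * b)) * (1# - q * b) * ((1# - b) * (t (suc (suc k)) * T))
        ≈⟨ solve 5 (λ q a b t T →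
             let x  = q :* a :* b
                 t₁ = :- ((q :* a) :* t)
                 t₂ = :- ((q :* (q :* a)) :* t₁)
             in
             (:1 :- q :* b) :* (:1 :- q :* (q :* (q :* (a :* x)))) :* (:1 :+ (q :* x) :* (q :* x)) :* (t₁ :* T)
             :- (q :* x) :* (:1 :- q :* (q :* (a :* x))) :* (:1 :- q :* (q :* (q :* (a :* x)))) :* (t :* T)
             :- (q :* x) :* (:1 :- q :* b) :* ((:1 :- b) :* (t₂ :* T)) :=
             t₁ :* (T :* (:1 :- (q :* x) :* (q :* x)) :* (:1 :- q :* ((q :* x) :* (q :* x)))))
             refl q a b (t k) T ⟩
      t (suc k) * (T * (1# - (q * (q * a * b)) * (q * (q * a * b))) * (1# - q * ((q * (q * a * b)) * (q * (q * a * b)))))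
        ≈⟨ *-congˡ (*-cong (*-congˡ (+-congˡ (-‿cong (*-cong (*-congˡ x≈) (*-congˡ x≈)))))
                           (+-congˡ (-‿cong (*-congˡ (*-cong (*-congˡ x≈) (*-congˡ x≈)))))) ⟨
      t (suc k) * (T * (1# - (q * x) * (q * x)) * (1# - q * ((q * x) * (q * x))))
        ≈⟨ *-congˡ (P-odd-step n) ⟨
      t (suc k) * P (suc (suc n ℕ.+ suc n)) ∎
      where
      x a b T : Carrier
      x = q ^ n
      a = q ^ k
      b = q ^ j
      T = P (suc (n ℕ.+ n))

      1+k+j≡n : suc k ℕ.+ j ≡ n
      1+k+j≡n = ≡.trans (≡.sym (ℕ.+-suc k j)) (ℕ.suc-injective k+j≡n)

      x≈ : x ≈ q * a * b
      x≈ = trans (^-congʳ q (≡.sym 1+k+j≡n)) (^-homo-* q (suc k) j)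

      y≈ : q ^ (k ℕ.+ n) ≈ a * (q * a * b)
      y≈ = trans (^-homo-* q k n) (*-congˡ x≈)

    -- The limiting form of the Gaussian binomial: modulo q^(N+1), the products of index N+k+1 and
    -- 2N+1 both agree with `P N`, and next to `t k` so does `P j`. Cancelling `P j` leaves 1 /
    -- `P N` for the binomial.
    P*d≈t : ∀ k → k ℕ.≤ N → P N * d N k ≈ t k
    P*d≈t k k≤N = P-cancelˡ j (begin
      P j * (P N * d N k)                  ≈⟨ *-assoc _ _ _ ⟨
      P j * P N * d N k                    ≈⟨ *-congʳ (*-congˡ (P-stable (suc (k ℕ.+ N)) (ℕ.m≤n⇒m≤1+n (ℕ.m≤n+m N k)))) ⟨
      P j * P (suc (k ℕ.+ N)) * d N k      ≈⟨ d-closed N k j k+j≡N ⟩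
      t k * P (suc (N ℕ.+ N))              ≈⟨ *-congˡ (P-stable (suc (N ℕ.+ N)) (ℕ.m≤n⇒m≤1+n (ℕ.m≤n+m N N))) ⟩
      t k * P N                            ≈⟨ t*P-stable k j k+j≡N ⟩
      t k * P j                            ≈⟨ *-comm _ _ ⟩
      P j * t k                            ∎)
      where
      j : ℕ
      j = N ℕ.∸ k

      k+j≡N : k ℕ.+ j ≡ N
      k+j≡N = ℕ.m+[n∸m]≡n k≤N

    P³≈Σ-odd*t : P N ^ 3 ≈ Σ< (suc N) (λ k → odd k * t k)
    P³≈Σ-odd*t = begin
      P N ^ 3                                    ≈⟨ *-congˡ (*-congˡ (*-identityʳ _)) ⟩
      P N * (P N * P N)                          ≈⟨ *-congˡ (Σ-odd*d {N} ℕ.≤-refl) ⟨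
      P N * Σ< (suc N) (λ k → odd k * d N k)     ≈⟨ *-distribˡ-Σ< (suc N) _ _ ⟩
      Σ< (suc N) (λ k → P N * (odd k * d N k))
        ≈⟨ Σ<-cong (suc N) (λ {k} k≤N → trans (solve 3 (λ a b c → a :* (b :* c) := b :* (a :* c)) refl _ _ _)
             (*-congˡ (P*d≈t k (ℕ.≤-pred k≤N)))) ⟩
      Σ< (suc N) (λ k → odd k * t k)             ∎

-- The ring of power series, read modulo p and q^(N+1)

PowerSeries : Set
PowerSeries = ℕ → ℤ

module PowerSeriesOperations where
  open import Data.Integer using (_+_; _*_; -_)
  open ≡ using (refl; sym; trans; cong; cong₂; module ≡-Reasoning)

  infixl 7 _⋆_
  infixl 6 _⊕_

  _⊕_ : PowerSeries → PowerSeries → PowerSeries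
  (f ⊕ g) n = f n + g n

  ⊖_ : PowerSeries → PowerSeries
  (⊖ f) n = - f n

  constant : ℤ → PowerSeries
  constant c zero    = c
  constant c (suc n) = + 0

  X : PowerSeries
  X zero    = + 0
  X (suc n) = constant (+ 1) n

  _⋆_ : PowerSeries → PowerSeries → PowerSeries
  (f ⋆ g) zero    = f 0 * g 0
  (f ⋆ g) (suc n) = f 0 * g (suc n) + ((f ∘ suc) ⋆ g) n

  -- The mirror image of the defining clause, splitting the Cauchy sum at its other end; the two
  -- together give commutativity by induction.
  ⋆-suc : ∀ f g n → (f ⋆ g) (suc n) ≡ (f ⋆ (g ∘ suc)) n + f (suc n) * g 0
  ⋆-suc f g zero    = refl
  ⋆-suc f g (suc n) = trans
    (cong₂ _+_ {f 0 * g (2 ℕ.+ n)} refl (⋆-suc (f ∘ suc) g n))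
    (sym (ℤ.+-assoc (f 0 * g (2 ℕ.+ n)) _ _))

  ⋆-comm : ∀ f g → f ⋆ g ≗ g ⋆ f
  ⋆-comm f g zero    = ℤ.*-comm (f 0) (g 0)
  ⋆-comm f g (suc n) = begin
    f 0 * g (suc n) + ((f ∘ suc) ⋆ g) n  ≡⟨ cong₂ _+_ (ℤ.*-comm (f 0) _) (⋆-comm (f ∘ suc) g n) ⟩
    g (suc n) * f 0 + (g ⋆ (f ∘ suc)) n  ≡⟨ ℤ.+-comm (g (suc n) * f 0) _ ⟩
    (g ⋆ (f ∘ suc)) n + g (suc n) * f 0  ≡⟨ ⋆-suc g f n ⟨
    (g ⋆ f) (suc n)                      ∎
    where open ≡-Reasoning

  ⋆-distribʳ-⊕ : ∀ h f g → (f ⊕ g) ⋆ h ≗ (f ⋆ h) ⊕ (g ⋆ h)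
  ⋆-distribʳ-⊕ h f g zero    = ℤ.*-distribʳ-+ (h 0) (f 0) (g 0)
  ⋆-distribʳ-⊕ h f g (suc n) = trans
    (cong₂ _+_ {(f 0 + g 0) * h (suc n)} refl (⋆-distribʳ-⊕ h (f ∘ suc) (g ∘ suc) n))
    (rearrange (f 0) (g 0) (h (suc n)) (((f ∘ suc) ⋆ h) n) (((g ∘ suc) ⋆ h) n))
    where
    rearrange : ∀ a b c x y → (a + b) * c + (x + y) ≡ (a * c + x) + (b * c + y)
    rearrange = solve-∀

  *-⋆-assoc : ∀ c f g n → ((λ k → c * f k) ⋆ g) n ≡ c * (f ⋆ g) n
  *-⋆-assoc c f g zero    = ℤ.*-assoc c (f 0) (g 0)
  *-⋆-assoc c f g (suc n) = trans (cong₂ _+_ {c * f 0 * g (suc n)} refl (*-⋆-assoc c (f ∘ suc) g n))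
    (rearrange c (f 0) (g (suc n)) (((f ∘ suc) ⋆ g) n))
    where
    rearrange : ∀ c a b x → c * a * b + c * x ≡ c * (a * b + x)
    rearrange = solve-∀

  ⋆-assoc : ∀ f g h → (f ⋆ g) ⋆ h ≗ f ⋆ (g ⋆ h)
  ⋆-assoc f g h zero    = ℤ.*-assoc (f 0) (g 0) (h 0)
  ⋆-assoc f g h (suc n) = begin
    f 0 * g 0 * h (suc n) + (((λ k → f 0 * g (suc k)) ⊕ ((f ∘ suc) ⋆ g)) ⋆ h) n
      ≡⟨ cong₂ _+_ {f 0 * g 0 * h (suc n)} refl (⋆-distribʳ-⊕ h (λ k → f 0 * g (suc k)) ((f ∘ suc) ⋆ g) n) ⟩
    f 0 * g 0 * h (suc n) + (((λ k → f 0 * g (suc k)) ⋆ h) n + (((f ∘ suc) ⋆ g) ⋆ h) n)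
      ≡⟨ cong₂ _+_ {f 0 * g 0 * h (suc n)} refl
           (cong₂ _+_ (*-⋆-assoc (f 0) (g ∘ suc) h n) (⋆-assoc (f ∘ suc) g h n)) ⟩
    f 0 * g 0 * h (suc n) + (f 0 * ((g ∘ suc) ⋆ h) n + ((f ∘ suc) ⋆ (g ⋆ h)) n)
      ≡⟨ rearrange (f 0) (g 0) (h (suc n)) (((g ∘ suc) ⋆ h) n) (((f ∘ suc) ⋆ (g ⋆ h)) n) ⟩
    f 0 * (g ⋆ h) (suc n) + ((f ∘ suc) ⋆ (g ⋆ h)) n ∎
    where
    open ≡-Reasoning
    rearrange : ∀ a b c x y → a * b * c + (a * x + y) ≡ a * (b * c + x) + y
    rearrange = solve-∀

  0⋆ : ∀ f n → ((λ _ → + 0) ⋆ f) n ≡ + 0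
  0⋆ f zero    = refl
  0⋆ f (suc n) = trans (ℤ.+-identityˡ _) (0⋆ f n)

  constant-⋆ : ∀ c f n → (constant c ⋆ f) n ≡ c * f n
  constant-⋆ c f zero    = refl
  constant-⋆ c f (suc n) = trans (cong₂ _+_ {c * f (suc n)} refl (0⋆ f n)) (ℤ.+-identityʳ _)

  X-⋆-suc : ∀ f n → (X ⋆ f) (suc n) ≡ f n
  X-⋆-suc f n = trans (ℤ.+-identityˡ _) (trans (constant-⋆ (+ 1) f n) (ℤ.*-identityˡ (f n)))

module TruncatedSeries (p N : ℕ) where
  open import Data.Integer using (_+_; _*_; _-_; -_)
  open ≡ using (refl; sym; trans; cong; cong₂; subst)
  open PowerSeriesOperations

  infix 4 _≡ₚ_ _≈_

  -- A record, because x and y cannot be recovered from their difference when they are left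
  -- implicit.
  record _≡ₚ_ (x y : ℤ) : Set where
    constructor mk≡ₚ
    field
      p∣difference : + p ℤ.∣ x - y
  open _≡ₚ_ public

  ≡ₚ-reflexive : ∀ {x y} → x ≡ y → x ≡ₚ y
  ≡ₚ-reflexive {x} refl = mk≡ₚ (ℤ.divides (+ 0) (ℤ.+-inverseʳ x))

  ≡ₚ-sym : ∀ {x y} → x ≡ₚ y → y ≡ₚ x
  ≡ₚ-sym {x} {y} (mk≡ₚ d) = mk≡ₚ (subst (+ p ℤ.∣_) (rearrange x y) (ℤ.∣m⇒∣-m d))
    where
    rearrange : ∀ x y → - (x - y) ≡ y - x
    rearrange = solve-∀

  ≡ₚ-trans : ∀ {x y z} → x ≡ₚ y → y ≡ₚ z → x ≡ₚ z
  ≡ₚ-trans {x} {y} {z} (mk≡ₚ d) (mk≡ₚ e) = mk≡ₚ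
    (subst (+ p ℤ.∣_) (rearrange x y z) (ℤ.∣m∣n⇒∣m+n d e))
    where
    rearrange : ∀ x y z → (x - y) + (y - z) ≡ x - z
    rearrange = solve-∀

  +-congₚ : ∀ {x y u v} → x ≡ₚ y → u ≡ₚ v → x + u ≡ₚ y + v
  +-congₚ {x} {y} {u} {v} (mk≡ₚ d) (mk≡ₚ e) = mk≡ₚ
    (subst (+ p ℤ.∣_) (rearrange x y u v) (ℤ.∣m∣n⇒∣m+n d e))
    where
    rearrange : ∀ x y u v → (x - y) + (u - v) ≡ (x + u) - (y + v)
    rearrange = solve-∀

  -‿congₚ : ∀ {x y} → x ≡ₚ y → - x ≡ₚ - y
  -‿congₚ {x} {y} (mk≡ₚ d) = mk≡ₚ (subst (+ p ℤ.∣_) (rearrange x y) (ℤ.∣m⇒∣-m d))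
    where
    rearrange : ∀ x y → - (x - y) ≡ (- x) - (- y)
    rearrange = solve-∀

  *-congₚ : ∀ {x y u v} → x ≡ₚ y → u ≡ₚ v → x * u ≡ₚ y * v
  *-congₚ {x} {y} {u} {v} (mk≡ₚ d) (mk≡ₚ e) = mk≡ₚ
    (subst (+ p ℤ.∣_) (rearrange x y u v) (ℤ.∣m∣n⇒∣m+n (ℤ.∣m⇒∣m*n u d) (ℤ.∣n⇒∣m*n y e)))
    where
    rearrange : ∀ x y u v → (x - y) * u + y * (u - v) ≡ x * u - y * v
    rearrange = solve-∀

  ∣⇒≡ₚ0 : ∀ {x} → + p ℤ.∣ x → x ≡ₚ + 0
  ∣⇒≡ₚ0 {x} d = mk≡ₚ (subst (+ p ℤ.∣_) (sym (ℤ.+-identityʳ x)) d)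

  ≡ₚ0⇒∣ : ∀ {x} → x ≡ₚ + 0 → + p ℤ.∣ x
  ≡ₚ0⇒∣ {x} (mk≡ₚ d) = subst (+ p ℤ.∣_) (ℤ.+-identityʳ x) d

  -- The hypothesis compares products, not factors, so that it also applies where one factor
  -- vanishes and the other is unrelated.
  ⋆-local : ∀ f g f′ g′ n →
    (∀ i j → i ℕ.+ j ≡ n → f i * g j ≡ₚ f′ i * g′ j) → (f ⋆ g) n ≡ₚ (f′ ⋆ g′) n
  ⋆-local f g f′ g′ zero    h = h 0 0 refl
  ⋆-local f g f′ g′ (suc n) h =
    +-congₚ (h 0 (suc n) refl) (⋆-local (f ∘ suc) g (f′ ∘ suc) g′ n (λ i j eq → h (suc i) j (cong suc eq)))

  -- Reduction modulo p and truncation after q^N sit in the equality alone; the operations stay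
  -- those of integer power series, and coefficients can be read off as plain integers.
  record _≈_ (f g : PowerSeries) : Set where
    constructor mk≈
    field
      coefficient : ∀ {n} → n ℕ.≤ N → f n ≡ₚ g n
  open _≈_ public

  exact : ∀ {f g} → f ≗ g → f ≈ g
  exact f≗g = mk≈ λ _ → ≡ₚ-reflexive (f≗g _)

  ⋆-cong : ∀ {f g u v} → f ≈ g → u ≈ v → f ⋆ u ≈ g ⋆ v
  ⋆-cong {f} {g} {u} {v} f≈g u≈v = mk≈ λ {n} n≤N → ⋆-local f u g v n λ
    { i j refl → *-congₚ (coefficient f≈g (ℕ.≤-trans (ℕ.m≤m+n i j) n≤N))
                         (coefficient u≈v (ℕ.≤-trans (ℕ.m≤n+m j i) n≤N)) }

  commutativeRing : CommutativeRing 0ℓ 0ℓ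
  commutativeRing = record
    { Carrier = PowerSeries
    ; _≈_ = _≈_
    ; _+_ = _⊕_
    ; _*_ = _⋆_
    ; -_ = ⊖_
    ; 0# = λ _ → + 0
    ; 1# = constant (+ 1)
    ; isCommutativeRing = record
      { isRing = record
        { +-isAbelianGroup = record
          { isGroup = record
            { isMonoid = record
              { isSemigroup = record
                { isMagma = record
                  { isEquivalence = record
                    { refl  = exact λ _ → refl
                    ; sym   = λ f≈g → mk≈ λ n≤N → ≡ₚ-sym (coefficient f≈g n≤N)
                    ; trans = λ f≈g g≈h → mk≈ λ n≤N → ≡ₚ-trans (coefficient f≈g n≤N) (coefficient g≈h n≤N)
                    }
                  ; ∙-cong = λ f≈g u≈v → mk≈ λ n≤N → +-congₚ (coefficient f≈g n≤N) (coefficient u≈v n≤N)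
                  }
                ; assoc = λ f g h → exact λ n → ℤ.+-assoc (f n) (g n) (h n)
                }
              ; identity = (λ f → exact λ n → ℤ.+-identityˡ (f n))
                         , (λ f → exact λ n → ℤ.+-identityʳ (f n))
              }
            ; inverse = (λ f → exact λ n → ℤ.+-inverseˡ (f n))
                      , (λ f → exact λ n → ℤ.+-inverseʳ (f n))
            ; ⁻¹-cong = λ f≈g → mk≈ λ n≤N → -‿congₚ (coefficient f≈g n≤N)
            }
          ; comm = λ f g → exact λ n → ℤ.+-comm (f n) (g n)
          }
        ; *-cong = ⋆-cong
        ; *-assoc = λ f g h → exact (⋆-assoc f g h)
        ; *-identity = (λ f → exact (1⋆ f)) , (λ f → exact λ n → trans (⋆-comm f (constant (+ 1)) n) (1⋆ f n))
        ; distrib = (λ h f g → exact λ n → trans (⋆-comm h (f ⊕ g) n)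
                      (trans (⋆-distribʳ-⊕ h f g n) (cong₂ _+_ (⋆-comm f h n) (⋆-comm g h n))))
                  , (λ h f g → exact (⋆-distribʳ-⊕ h f g))
        }
      ; *-comm = λ f g → exact (⋆-comm f g)
      }
    }
    where
    1⋆ : ∀ f → constant (+ 1) ⋆ f ≗ f
    1⋆ f n = trans (constant-⋆ (+ 1) f n) (ℤ.*-identityˡ (f n))

  constants : ℤ-Constants commutativeRing
  constants = record
    { ⟦_⟧    = constant
    ; +-homo = λ c d → exact λ { zero → refl ; (suc n) → refl }
    ; *-homo = λ c d → exact λ n → trans (scale c d n) (sym (constant-⋆ c (constant d) n))
    ; -‿homo = λ c → exact λ { zero → refl ; (suc n) → refl }
    ; 0-homo = exact λ { zero → refl ; (suc n) → refl }
    ; 1-homo = exact λ _ → refl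
    }
    where
    scale : ∀ c d → constant (c * d) ≗ λ n → c * constant d n
    scale c d zero    = refl
    scale c d (suc n) = sym (ℤ.*-zeroʳ c)

  constant≈0 : ∀ c → + p ℤ.∣ c → constant c ≈ λ _ → + 0
  constant≈0 c p∣c = mk≈ λ { {zero} _ → ∣⇒≡ₚ0 p∣c ; {suc n} _ → ≡ₚ-reflexive refl }

-- Recurrences for partitions avoiding a part

module PartitionCounts where
  open import Data.Nat using (_+_; _∸_; _≤_; _<_; s≤s⁻¹; _≤?_)
  open import Data.Nat.Properties
    using (_≟_; ≤-refl; ≤-trans; m∸n≤m; m≤m+n; m≤n+m; m+n∸m≡n; +-identityʳ; <⇒≱; ≰⇒>)
  open ≡ using (refl; sym; trans; cong; cong₂; module ≡-Reasoning)

  count : (k ℓ b n : ℕ) → ℕ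
  count k ℓ b n = length (filter (k ∉?_) (boundedPartitions ℓ b n))

  filter-∉-map-≢ : ∀ {k b} → b ≢ k → ∀ ps →
    length (filter (k ∉?_) (map (b ∷_) ps)) ≡ length (filter (k ∉?_) ps)
  filter-∉-map-≢ b≢k [] = refl
  filter-∉-map-≢ {k} {b} b≢k (p ∷ ps) = by-cases (k ∉? p)
    where
    by-cases : Dec (k ∉ p) → length (filter (k ∉?_) (map (b ∷_) (p ∷ ps))) ≡ length (filter (k ∉?_) (p ∷ ps))
    by-cases (yes k∉p) = trans
      (cong length (filter-accept (k ∉?_) {b ∷ p} {map (b ∷_) ps}
        λ { (here refl) → b≢k refl ; (there k∈p) → k∉p k∈p }))
      (trans (cong suc (filter-∉-map-≢ b≢k ps)) (sym (cong length (filter-accept (k ∉?_) {xs = ps} k∉p))))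
    by-cases (no ¬k∉p) = trans
      (cong length (filter-reject (k ∉?_) {b ∷ p} {map (b ∷_) ps}
        λ k∉b∷p → ¬k∉p (λ k∈p → k∉b∷p (there k∈p))))
      (trans (filter-∉-map-≢ b≢k ps) (sym (cong length (filter-reject (k ∉?_) {xs = ps} ¬k∉p))))

  filter-∉-map-≡ : ∀ k ps → length (filter (k ∉?_) (map (k ∷_) ps)) ≡ 0
  filter-∉-map-≡ k ps = cong length
    (filter-none (k ∉?_) (List.map⁺ (List.universal (λ _ k∉k∷p → k∉k∷p (here refl)) ps)))

  count-suc-< : ∀ k ℓ {b n} → n < suc b → count k (suc ℓ) (suc b) n ≡ count k (suc ℓ) b n
  count-suc-< k ℓ {b} {n} n<1+b with suc b ≤? n
  ... | yes 1+b≤n = ⊥-elim (<⇒≱ n<1+b 1+b≤n)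
  ... | no  _     = refl

  count-suc-≥ : ∀ k ℓ {b n} → suc b ≤ n → count k (suc ℓ) (suc b) n ≡
    count k (suc ℓ) b n + length (filter (k ∉?_) (map (suc b ∷_) (boundedPartitions ℓ (suc b) (n ∸ suc b))))
  count-suc-≥ k ℓ {b} {n} 1+b≤n with suc b ≤? n
  ... | no  1+b≰n = ⊥-elim (1+b≰n 1+b≤n)
  ... | yes _     = trans (cong length (filter-++ (k ∉?_) (boundedPartitions (suc ℓ) b n) _))
                          (length-++ (filter (k ∉?_) (boundedPartitions (suc ℓ) b n)))

  count-suc-≢ : ∀ {k} ℓ {b n} → suc b ≤ n → suc b ≢ k →
    count k (suc ℓ) (suc b) n ≡ count k (suc ℓ) b n + count k ℓ (suc b) (n ∸ suc b)
  count-suc-≢ {k} ℓ {b} {n} 1+b≤n 1+b≢k =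
    trans (count-suc-≥ k ℓ 1+b≤n)
      (cong₂ _+_ {count k (suc ℓ) b n} refl (filter-∉-map-≢ 1+b≢k (boundedPartitions ℓ (suc b) (n ∸ suc b))))

  -- Raising the bound to the forbidden size admits only partitions that contain it, all of which
  -- the filter discards.
  count-suc-≡ : ∀ ℓ b n → count (suc b) (suc ℓ) (suc b) n ≡ count (suc b) (suc ℓ) b n
  count-suc-≡ ℓ b n with suc b ≤? n
  ... | no  _ = refl
  ... | yes _ = begin
    length (filter (suc b ∉?_) (xs ++ map (suc b ∷_) ys))
      ≡⟨ cong length (filter-++ (suc b ∉?_) xs _) ⟩
    length (filter (suc b ∉?_) xs ++ filter (suc b ∉?_) (map (suc b ∷_) ys))
      ≡⟨ length-++ (filter (suc b ∉?_) xs) ⟩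
    length (filter (suc b ∉?_) xs) + length (filter (suc b ∉?_) (map (suc b ∷_) ys))
      ≡⟨ cong₂ _+_ {length (filter (suc b ∉?_) xs)} refl (filter-∉-map-≡ (suc b) ys) ⟩
    length (filter (suc b ∉?_) xs) + 0
      ≡⟨ +-identityʳ _ ⟩
    length (filter (suc b ∉?_) xs) ∎
    where
    open ≡-Reasoning
    xs ys : List (List ℕ)
    xs = boundedPartitions (suc ℓ) b n
    ys = boundedPartitions ℓ (suc b) (n ∸ suc b)

  count-n≡0 : ∀ k ℓ b → count k ℓ b 0 ≡ 1
  count-n≡0 k zero    b       = refl
  count-n≡0 k (suc ℓ) zero    = refl
  count-n≡0 k (suc ℓ) (suc b) = count-n≡0 k (suc ℓ) b

  -- A partition of n has at most n parts, so any bound ℓ ≥ n on their number is vacuous.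
  count-ℓ-irrelevant : ∀ k ℓ ℓ′ b {n} → n ≤ ℓ → n ≤ ℓ′ → count k ℓ b n ≡ count k ℓ′ b n
  count-ℓ-irrelevant k ℓ ℓ′ b {zero} _ _ = trans (count-n≡0 k ℓ b) (sym (count-n≡0 k ℓ′ b))
  count-ℓ-irrelevant k (suc ℓ) (suc ℓ′) zero    {suc n} _ _ = refl
  count-ℓ-irrelevant k (suc ℓ) (suc ℓ′) (suc b) {suc n} n<ℓ n<ℓ′ = by-cases (suc b ≟ k) (suc b ≤? suc n)
    where
    fewer-parts : count k (suc ℓ) b (suc n) ≡ count k (suc ℓ′) b (suc n)
    fewer-parts = count-ℓ-irrelevant k (suc ℓ) (suc ℓ′) b n<ℓ n<ℓ′

    by-cases : Dec (suc b ≡ k) → Dec (suc b ≤ suc n) →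
      count k (suc ℓ) (suc b) (suc n) ≡ count k (suc ℓ′) (suc b) (suc n)
    by-cases (yes refl)  _         = trans (count-suc-≡ ℓ b (suc n))
      (trans fewer-parts (sym (count-suc-≡ ℓ′ b (suc n))))
    by-cases (no _)      (no b≮n)  = trans (count-suc-< k ℓ (≰⇒> b≮n))
      (trans fewer-parts (sym (count-suc-< k ℓ′ (≰⇒> b≮n))))
    by-cases (no 1+b≢k)  (yes b<n) = trans (count-suc-≢ ℓ b<n 1+b≢k)
      (trans (cong₂ _+_ fewer-parts
               (count-ℓ-irrelevant k ℓ ℓ′ (suc b) (≤-trans (m∸n≤m n b) (s≤s⁻¹ n<ℓ)) (≤-trans (m∸n≤m n b) (s≤s⁻¹ n<ℓ′))))
             (sym (count-suc-≢ ℓ′ b<n 1+b≢k)))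

  -- With the bound on the number of parts set to n, `avoiding k n n` is `ν k n` by definition.
  avoiding : (k b n : ℕ) → ℕ
  avoiding k b n = count k n b n

  avoiding-suc-≡ : ∀ b n → avoiding (suc b) (suc b) n ≡ avoiding (suc b) b n
  avoiding-suc-≡ b zero    = refl
  avoiding-suc-≡ b (suc n) = count-suc-≡ n b (suc n)

  avoiding-suc-< : ∀ k {b n} → n < suc b → avoiding k (suc b) n ≡ avoiding k b n
  avoiding-suc-< k {n = zero}  _     = refl
  avoiding-suc-< k {n = suc n} n<1+b = count-suc-< k n n<1+b

  -- Removing one part of size b + 1 leaves a partition of m, still listed with at most b + m parts;
  -- that bound is vacuous and can be lowered to m.
  avoiding-suc-+ : ∀ {k b} m → suc b ≢ k →
    avoiding k (suc b) (suc b + m) ≡ avoiding k b (suc b + m) + avoiding k (suc b) m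
  avoiding-suc-+ {k} {b} m 1+b≢k = begin
    avoiding k (suc b) (suc b + m)
      ≡⟨ count-suc-≢ (b + m) (m≤m+n (suc b) m) 1+b≢k ⟩
    avoiding k b (suc b + m) + count k (b + m) (suc b) (b + m ∸ b)
      ≡⟨ cong (λ i → avoiding k b (suc b + m) + count k (b + m) (suc b) i) (m+n∸m≡n b m) ⟩
    avoiding k b (suc b + m) + count k (b + m) (suc b) m
      ≡⟨ cong₂ _+_ {avoiding k b (suc b + m)} refl (count-ℓ-irrelevant k (b + m) m (suc b) (m≤n+m m b) ≤-refl) ⟩
    avoiding k b (suc b + m) + avoiding k (suc b) m ∎
    where open ≡-Reasoning

open PartitionCounts

-- Grading of series by exponents modulo p

module Components (p N : ℕ) where
  open PowerSeriesOperations using (X; constant; 0⋆; X-⋆-suc; ⋆-assoc)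
  open TruncatedSeries p N hiding (_≈_)
  open CommutativeRing commutativeRing hiding (zero)
  open import Algebra.Properties.CommutativeSemiring.Exp commutativeSemiring
  open import Algebra.Properties.Semiring.Sum semiring
  open import Relation.Binary.Reasoning.Setoid setoid
  open _-Raw-AlmostCommutative⟶_ constants using (0-homo)
  open Characteristic p commutativeRing constants constant≈0

  infix 4 _≡ₚ?_

  _≡ₚ?_ : ∀ x y → Dec (x ≡ₚ y)
  x ≡ₚ? y = map′ mk≡ₚ p∣difference (+ p ℤ.∣? (x ℤ.- y))

  ≡ₚ-refl : ∀ {x} → x ≡ₚ x
  ≡ₚ-refl = ≡ₚ-reflexive ≡.refl

  -- The disjunction can be analysed case by case without deciding membership in A.
  record SupportedOn (A : ℕ → Set) (f : Carrier) : Set where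
    constructor mkSupported
    field
      support : ∀ {n} → n ℕ.≤ N → A n ⊎ f n ≡ₚ + 0
  open SupportedOn public

  Homogeneous : ℤ → Carrier → Set
  Homogeneous r = SupportedOn (λ n → + n ≡ₚ r)

  module _ {A : ℕ → Set} where
    supported-≈ : ∀ {f g} → f ≈ g → SupportedOn A f → SupportedOn A g
    supported-≈ f≈g f-supp = mkSupported λ n≤N →
      Sum.map₂ (≡ₚ-trans (≡ₚ-sym (coefficient f≈g n≤N))) (support f-supp n≤N)

    supported-0 : SupportedOn A 0#
    supported-0 = mkSupported λ _ → inj₂ ≡ₚ-refl

    supported-+ : ∀ {f g} → SupportedOn A f → SupportedOn A g → SupportedOn A (f + g)
    supported-+ {f} {g} f-supp g-supp = mkSupported λ n≤N → sum-support (support f-supp n≤N) (support g-supp n≤N)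
      where
      sum-support : ∀ {n} → A n ⊎ f n ≡ₚ + 0 → A n ⊎ g n ≡ₚ + 0 → A n ⊎ (f + g) n ≡ₚ + 0
      sum-support (inj₁ a)  _         = inj₁ a
      sum-support (inj₂ _)  (inj₁ a)  = inj₁ a
      sum-support (inj₂ f0) (inj₂ g0) = inj₂ (+-congₚ f0 g0)

    supported-neg : ∀ {f} → SupportedOn A f → SupportedOn A (- f)
    supported-neg f-supp = mkSupported λ n≤N → Sum.map₂ -‿congₚ (support f-supp n≤N)

  supported-⊆ : ∀ {A B : ℕ → Set} {f} → (∀ {n} → A n → B n) → SupportedOn A f → SupportedOn B f
  supported-⊆ A⊆B f-supp = mkSupported λ n≤N → Sum.map₁ A⊆B (support f-supp n≤N)

  ⋆-vanishes : ∀ f g n → (∀ i j → i ℕ.+ j ≡ n → f i ℤ.* g j ≡ₚ + 0) → (f * g) n ≡ₚ + 0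
  ⋆-vanishes f g n h = ≡ₚ-trans (⋆-local f g 0# g n h) (≡ₚ-reflexive (0⋆ g n))

  +≡ₚ⇒≡ₚ- : ∀ {i j r s} → + i ≡ₚ s → + (i ℕ.+ j) ≡ₚ r → + j ≡ₚ r ℤ.- s
  +≡ₚ⇒≡ₚ- {i} {j} i≡s i+j≡r =
    ≡ₚ-trans (≡ₚ-reflexive (rearrange (+ i) (+ j))) (+-congₚ i+j≡r (-‿congₚ i≡s))
    where
    rearrange : ∀ x y → y ≡ (x ℤ.+ y) ℤ.- x
    rearrange = solve-∀

  ≡ₚ-⇒+≡ₚ : ∀ {i j r s} → + i ≡ₚ s → + j ≡ₚ r ℤ.- s → + (i ℕ.+ j) ≡ₚ r
  ≡ₚ-⇒+≡ₚ {r = r} {s} i≡s j≡r-s = ≡ₚ-trans (+-congₚ i≡s j≡r-s) (≡ₚ-reflexive (rearrange r s))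
    where
    rearrange : ∀ r s → s ℤ.+ (r ℤ.- s) ≡ r
    rearrange = solve-∀

  homogeneous-⋆ : ∀ {r s f g} → Homogeneous r f → Homogeneous s g → Homogeneous (r ℤ.+ s) (f * g)
  homogeneous-⋆ {r} {s} {f} {g} f-hom g-hom = mkSupported λ n≤N → by-cases n≤N (_ ≡ₚ? (r ℤ.+ s))
    where
    by-cases : ∀ {n} → n ℕ.≤ N → Dec (+ n ≡ₚ (r ℤ.+ s)) → + n ≡ₚ (r ℤ.+ s) ⊎ (f * g) n ≡ₚ + 0
    by-cases     n≤N (yes n≡r+s) = inj₁ n≡r+s
    by-cases {n} n≤N (no  n≢r+s) = inj₂ (⋆-vanishes f g n products)
      where
      products : ∀ i j → i ℕ.+ j ≡ n → f i ℤ.* g j ≡ₚ + 0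
      products i j ≡.refl
        with support f-hom (ℕ.≤-trans (ℕ.m≤m+n i j) n≤N) | support g-hom (ℕ.≤-trans (ℕ.m≤n+m j i) n≤N)
      ... | inj₁ i≡r | inj₁ j≡s = ⊥-elim (n≢r+s (+-congₚ i≡r j≡s))
      ... | inj₂ f0  | _        = *-congₚ f0 (≡ₚ-refl {g j})
      ... | inj₁ _   | inj₂ g0  = ≡ₚ-trans (*-congₚ (≡ₚ-refl {f i}) g0) (≡ₚ-reflexive (ℤ.*-zeroʳ (f i)))

  homogeneous-≡ₚ : ∀ {r s f} → r ≡ₚ s → Homogeneous r f → Homogeneous s f
  homogeneous-≡ₚ r≡s = supported-⊆ (λ n≡r → ≡ₚ-trans n≡r r≡s)

  homogeneous-constant : ∀ c → Homogeneous (+ 0) (constant c)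
  homogeneous-constant c = mkSupported λ { {zero} _ → inj₁ ≡ₚ-refl ; {suc n} _ → inj₂ ≡ₚ-refl }

  homogeneous-1 : Homogeneous (+ 0) 1#
  homogeneous-1 = homogeneous-constant (+ 1)

  homogeneous-X : Homogeneous (+ 1) X
  homogeneous-X = mkSupported λ
    { {zero}        _ → inj₂ ≡ₚ-refl
    ; {suc zero}    _ → inj₁ ≡ₚ-refl
    ; {suc (suc n)} _ → inj₂ ≡ₚ-refl
    }

  homogeneous-^ : ∀ {r f} n → Homogeneous r f → Homogeneous (+ n ℤ.* r) (f ^ n)
  homogeneous-^ zero    f-hom = homogeneous-1
  homogeneous-^ {r} (suc n) f-hom =
    homogeneous-≡ₚ (≡ₚ-reflexive (rearrange (+ n) r)) (homogeneous-⋆ f-hom (homogeneous-^ n f-hom))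
    where
    rearrange : ∀ m r → r ℤ.+ m ℤ.* r ≡ (+ 1 ℤ.+ m) ℤ.* r
    rearrange = solve-∀

  homogeneous-X^ : ∀ n → Homogeneous (+ n) (X ^ n)
  homogeneous-X^ n = homogeneous-≡ₚ (≡ₚ-reflexive (ℤ.*-identityʳ (+ n))) (homogeneous-^ n homogeneous-X)

  component : ℤ → Carrier → Carrier
  component r f n with + n ≡ₚ? r
  ... | yes _ = f n
  ... | no  _ = + 0

  component-≡ : ∀ {r n} f → + n ≡ₚ r → component r f n ≡ f n
  component-≡ {r} {n} f n≡r with + n ≡ₚ? r
  ... | yes _   = ≡.refl
  ... | no  n≢r = ⊥-elim (n≢r n≡r)

  component-≢ : ∀ {r n} f → ¬ + n ≡ₚ r → component r f n ≡ + 0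
  component-≢ {r} {n} f n≢r with + n ≡ₚ? r
  ... | yes n≡r = ⊥-elim (n≢r n≡r)
  ... | no  _   = ≡.refl

  homogeneous-component : ∀ r f → Homogeneous r (component r f)
  homogeneous-component r f = mkSupported λ {n} _ → by-cases n
    where
    by-cases : ∀ n → + n ≡ₚ r ⊎ component r f n ≡ₚ + 0
    by-cases n with + n ≡ₚ? r
    ... | yes n≡r = inj₁ n≡r
    ... | no  _   = inj₂ ≡ₚ-refl

  component-cong : ∀ r {f g} → f ≈ g → component r f ≈ component r g
  component-cong r {f} {g} f≈g = mk≈ coefficients
    where
    coefficients : ∀ {n} → n ℕ.≤ N → component r f n ≡ₚ component r g n
    coefficients {n} n≤N with + n ≡ₚ? r
    ... | yes _ = coefficient f≈g n≤N
    ... | no  _ = ≡ₚ-refl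

  component-+ : ∀ r f g → component r (f + g) ≈ component r f + component r g
  component-+ r f g = exact coefficients
    where
    coefficients : component r (f + g) ≗ component r f + component r g
    coefficients n with + n ≡ₚ? r
    ... | yes _ = ≡.refl
    ... | no  _ = ≡.refl

  component-0 : ∀ r → component r 0# ≈ 0#
  component-0 r = exact coefficients
    where
    coefficients : component r 0# ≗ 0#
    coefficients n with + n ≡ₚ? r
    ... | yes _ = ≡.refl
    ... | no  _ = ≡.refl

  component-sum : ∀ r {m} (f : Fin m → Carrier) → component r (sum f) ≈ sum (component r ∘ f)
  component-sum r {zero}  f = component-0 r
  component-sum r {suc m} f = trans (component-+ r (f zero) (sum (f ∘ suc)))
    (+-congˡ {component r (f zero)} (component-sum r (f ∘ suc)))

  component-⋆ : ∀ r {s} f g → Homogeneous s f → component r (f * g) ≈ f * component (r ℤ.- s) g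
  component-⋆ r {s} f g f-hom = mk≈ λ n≤N → by-cases n≤N (_ ≡ₚ? r)
    where
    by-cases : ∀ {n} → n ℕ.≤ N → Dec (+ n ≡ₚ r) → component r (f * g) n ≡ₚ (f * component (r ℤ.- s) g) n
    by-cases {n} n≤N (yes n≡r) = ≡ₚ-trans (≡ₚ-reflexive (component-≡ (f * g) n≡r))
      (⋆-local f g f (component (r ℤ.- s) g) n products)
      where
      products : ∀ i j → i ℕ.+ j ≡ n → f i ℤ.* g j ≡ₚ f i ℤ.* component (r ℤ.- s) g j
      products i j ≡.refl with support f-hom (ℕ.≤-trans (ℕ.m≤m+n i j) n≤N)
      ... | inj₁ i≡s = ≡ₚ-reflexive (≡.cong (f i ℤ.*_) (≡.sym (component-≡ g (+≡ₚ⇒≡ₚ- i≡s n≡r))))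
      ... | inj₂ f0  = ≡ₚ-trans (*-congₚ f0 (≡ₚ-refl {g j}))
                                (≡ₚ-sym (*-congₚ f0 (≡ₚ-refl {component (r ℤ.- s) g j})))
    by-cases {n} n≤N (no n≢r) = ≡ₚ-trans (≡ₚ-reflexive (component-≢ (f * g) n≢r))
      (≡ₚ-sym (⋆-vanishes f (component (r ℤ.- s) g) n products))
      where
      products : ∀ i j → i ℕ.+ j ≡ n → f i ℤ.* component (r ℤ.- s) g j ≡ₚ + 0
      products i j ≡.refl with support f-hom (ℕ.≤-trans (ℕ.m≤m+n i j) n≤N)
      ... | inj₁ i≡s = ≡ₚ-reflexive
        (≡.trans (≡.cong (f i ℤ.*_) (component-≢ g λ j≡r-s → n≢r (≡ₚ-⇒+≡ₚ i≡s j≡r-s))) (ℤ.*-zeroʳ (f i)))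
      ... | inj₂ f0  = *-congₚ f0 (≡ₚ-refl {component (r ℤ.- s) g j})

  -- Multiplication by a series in q^p preserves every residue class. This is how E^p and E V are
  -- moved out of a component.
  component-⋆₀ : ∀ r f g → Homogeneous (+ 0) f → component r (f * g) ≈ f * component r g
  component-⋆₀ r f g f-hom = trans (component-⋆ r f g f-hom)
    (*-congˡ {f} (reflexive (≡.cong (λ s → component s g) (ℤ.+-identityʳ r))))

  Residues : ∀ {m} → Vec ℤ m → ℕ → Set
  Residues w n = Any (+ n ≡ₚ_) w

  components : ∀ {m} → Vec ℤ m → Carrier → Vec Carrier m
  components w f = Vec.map (λ r → component r f) w

  component-outside : ∀ {m} (w : Vec ℤ m) r f →
    ¬ Any (r ≡ₚ_) w → SupportedOn (Residues w) f → component r f ≈ 0#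
  component-outside w r f r∉w f-supp = mk≈ λ n≤N → by-cases n≤N (_ ≡ₚ? r)
    where
    shift : ∀ {n m} {w : Vec ℤ m} → + n ≡ₚ r → Any (+ n ≡ₚ_) w → Any (r ≡ₚ_) w
    shift n≡r (here n≡w)  = here (≡ₚ-trans (≡ₚ-sym n≡r) n≡w)
    shift n≡r (there n∈w) = there (shift n≡r n∈w)

    by-cases : ∀ {n} → n ℕ.≤ N → Dec (+ n ≡ₚ r) → component r f n ≡ₚ + 0
    by-cases n≤N (no n≢r) = ≡ₚ-reflexive (component-≢ f n≢r)
    by-cases n≤N (yes n≡r) with support f-supp n≤N
    ... | inj₁ n∈w = ⊥-elim (r∉w (shift n≡r n∈w))
    ... | inj₂ f0  = ≡ₚ-trans (≡ₚ-reflexive (component-≡ f n≡r)) f0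

  Distinct : ∀ {m} → Vec ℤ m → Set
  Distinct = AllPairs (λ r s → ¬ r ≡ₚ s)

  component-outside-sum : ∀ {m n} (w : Vec ℤ m) f → ¬ Residues w n →
    sum (λ i → component (lookup w i) f) n ≡ + 0
  component-outside-sum []      f n∉w = ≡.refl
  component-outside-sum (r ∷ w) f n∉w =
    ≡.cong₂ ℤ._+_ (component-≢ f (n∉w ∘ here)) (component-outside-sum w f (n∉w ∘ there))

  sum-components-inside : ∀ {m n} {w : Vec ℤ m} f → Distinct w → Residues w n →
    sum (λ i → component (lookup w i) f) n ≡ f n
  sum-components-inside {n = n} {r ∷ w} f (r∉w ∷ _) (here n≡r) =
    ≡.trans (≡.cong₂ ℤ._+_ (component-≡ f n≡r) (component-outside-sum w f (n∉w r∉w))) (ℤ.+-identityʳ (f n))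
    where
    n∉w : ∀ {m} {w : Vec ℤ m} → All (λ s → ¬ r ≡ₚ s) w → ¬ Residues w n
    n∉w (r≢s ∷ _) (here n≡s)  = r≢s (≡ₚ-trans (≡ₚ-sym n≡r) n≡s)
    n∉w (_ ∷ r∉w) (there n∈w) = n∉w r∉w n∈w
  sum-components-inside {n = n} {r ∷ w} f (r∉w ∷ distinct) (there n∈w) =
    ≡.trans (≡.cong₂ ℤ._+_ (component-≢ f (n≢r r∉w n∈w)) (sum-components-inside f distinct n∈w))
      (ℤ.+-identityˡ (f n))
    where
    n≢r : ∀ {m} {w : Vec ℤ m} → All (λ s → ¬ r ≡ₚ s) w → Residues w n → ¬ + n ≡ₚ r
    n≢r (r≢s ∷ _) (here n≡s)  n≡r = r≢s (≡ₚ-trans (≡ₚ-sym n≡r) n≡s)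
    n≢r (_ ∷ r∉w) (there n∈w) n≡r = n≢r r∉w n∈w n≡r

  -- Distinctness modulo p ensures that each coefficient is picked up by exactly one part of the
  -- sum.
  sum-components : ∀ {m} (w : Vec ℤ m) f → Distinct w → SupportedOn (Residues w) f →
    f ≈ sum (λ i → component (lookup w i) f)
  sum-components w f distinct f-supp = mk≈ coefficients
    where
    vanishing : ∀ {m n} (w : Vec ℤ m) → f n ≡ₚ + 0 → sum (λ i → component (lookup w i) f) n ≡ₚ + 0
    vanishing         []      f0 = ≡ₚ-refl
    vanishing {n = n} (r ∷ w) f0 with + n ≡ₚ? r
    ... | yes _ = +-congₚ f0 (vanishing w f0)
    ... | no  _ = +-congₚ (≡ₚ-refl {+ 0}) (vanishing w f0)

    coefficients : ∀ {n} → n ℕ.≤ N → f n ≡ₚ sum (λ i → component (lookup w i) f) n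
    coefficients n≤N with support f-supp n≤N
    ... | inj₁ n∈w = ≡ₚ-reflexive (≡.sym (sum-components-inside f distinct n∈w))
    ... | inj₂ f0  = ≡ₚ-trans f0 (≡ₚ-sym (vanishing w f0))

  ⟦Σ-poly⟧ : ∀ {m n} (f : Fin m → Polynomial n) ρ → ⟦ Σ-poly f ⟧ ρ ≈ sum (λ i → ⟦ f i ⟧ ρ)
  ⟦Σ-poly⟧ {zero}  f ρ = constant≈0 (+ 0) (ℤ.divides (+ 0) ≡.refl)
  ⟦Σ-poly⟧ {suc m} f ρ = +-congˡ {⟦ f zero ⟧ ρ} (⟦Σ-poly⟧ (f ∘ suc) ρ)

  component-1 : ∀ {n} r (ρ : Env n) → component r 1# ≈ ⟦ δ r ⟧ ρ
  component-1 r ρ = by-cases (+ p ℤ.∣? r)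
    where
    by-cases : Dec (+ p ℤ.∣ r) → component r 1# ≈ ⟦ δ r ⟧ ρ
    by-cases (yes p∣r) = trans (exact coefficients) (reflexive (≡.sym (⟦δ⟧-∣ p∣r ρ)))
      where
      coefficients : component r 1# ≗ 1#
      coefficients zero = component-≡ 1# (≡ₚ-sym (∣⇒≡ₚ0 p∣r))
      coefficients (suc n) with + suc n ≡ₚ? r
      ... | yes _ = ≡.refl
      ... | no  _ = ≡.refl
    by-cases (no p∤r) = trans (exact coefficients) (trans (sym 0-homo) (reflexive (≡.sym (⟦δ⟧-∤ p∤r ρ))))
      where
      coefficients : component r 1# ≗ 0#
      coefficients zero = component-≢ 1# (λ 0≡r → p∤r (≡ₚ0⇒∣ (≡ₚ-sym 0≡r)))
      coefficients (suc n) with + suc n ≡ₚ? r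
      ... | yes _ = ≡.refl
      ... | no  _ = ≡.refl

  -- Expanding f into its homogeneous parts reduces the vanishing of a residue class of f^k to a
  -- statement about one formal polynomial in m variables, independent of N and accessible to the
  -- solver.
  component-^ : ∀ {m} (w : Vec ℤ m) f → Distinct w → SupportedOn (Residues w) f →
    ∀ k r → component r (f ^ k) ≈ ⟦ power-component w k r ⟧ (components w f)
  component-^ w f distinct f-supp zero    r = component-1 r (components w f)
  component-^ w f distinct f-supp (suc k) r = begin
    component r (f * f ^ k)
      ≈⟨ component-cong r (trans (*-congʳ {f ^ k} (sum-components w f distinct f-supp))
           (*-distribʳ-sum (f ^ k) (λ i → component (lookup w i) f))) ⟩
    component r (sum λ i → component (lookup w i) f * f ^ k)
      ≈⟨ component-sum r (λ i → component (lookup w i) f * f ^ k) ⟩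
    sum (λ i → component r (component (lookup w i) f * f ^ k))
      ≈⟨ sum-cong-≋ (λ i → trans
           (component-⋆ r (component (lookup w i) f) (f ^ k) (homogeneous-component (lookup w i) f))
           (*-cong (reflexive (≡.sym (lookup-map i (λ s → component s f) w)))
                   (component-^ w f distinct f-supp k (r ℤ.- lookup w i)))) ⟩
    sum (λ i → lookup (components w f) i * ⟦ power-component w k (r ℤ.- lookup w i) ⟧ (components w f))
      ≈⟨ ⟦Σ-poly⟧ (λ i → var i :* power-component w k (r ℤ.- lookup w i)) (components w f) ⟨
    ⟦ power-component w (suc k) r ⟧ (components w f) ∎

-- Triangular numbers and periodicity modulo p

tri : ℕ → ℕ
tri zero    = 0
tri (suc k) = suc k ℕ.+ tri k

tri-+ : ∀ m k → tri (m ℕ.+ k) ≡ tri m ℕ.+ tri k ℕ.+ m ℕ.* k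
tri-+ zero    k = ≡.sym (ℕ.+-identityʳ (tri k))
tri-+ (suc m) k = ≡.trans (≡.cong (suc m ℕ.+ k ℕ.+_) (tri-+ m k)) (rearrange m k (tri m) (tri k))
  where
  rearrange : ∀ m k a b → suc m ℕ.+ k ℕ.+ (a ℕ.+ b ℕ.+ m ℕ.* k) ≡ suc m ℕ.+ a ℕ.+ b ℕ.+ (k ℕ.+ m ℕ.* k)
  rearrange = ℕ-solve-∀

periodic : ∀ p .{{_ : ℕ.NonZero p}} {A : ℕ → Set} →
  (∀ k → A k → A (p ℕ.+ k)) → (∀ {i} → i ℕ.< p → A i) → ∀ k → A k
periodic p {A} step base k = ≡.subst A
  (≡.trans (ℕ.+-comm (k ℕ./ p ℕ.* p) (k ℕ.% p)) (≡.sym (ℕ.m≡m%n+[m/n]*n k p)))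
  (go (k ℕ./ p))
  where
  go : ∀ m → A (m ℕ.* p ℕ.+ k ℕ.% p)
  go zero    = base (ℕ.m%n<n k p)
  go (suc m) = ≡.subst A (≡.sym (ℕ.+-assoc p (m ℕ.* p) (k ℕ.% p))) (step _ (go m))

-- Generating functions of partitions and the common argument

module Partitions (p N : ℕ) where
  open PowerSeriesOperations using (X; constant; constant-⋆; X-⋆-suc; _⋆_; ⋆-assoc)
  open TruncatedSeries p N hiding (_≈_)
  open CommutativeRing commutativeRing hiding (zero)
  open import Algebra.Properties.CommutativeSemiring.Exp commutativeSemiring
  open import Algebra.Properties.Ring ring using ([y-z]x≈yx-zx)
  open Components p N
  open EulerProducts commutativeRing constants

  X^-*-+ : ∀ m f n → (X ^ m * f) (m ℕ.+ n) ≡ f n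
  X^-*-+ zero    f n = ≡.trans (constant-⋆ (+ 1) f n) (ℤ.*-identityˡ (f n))
  X^-*-+ (suc m) f n = ≡.trans (⋆-assoc X (X ^ m) f (suc (m ℕ.+ n)))
    (≡.trans (X-⋆-suc (X ^ m * f) (m ℕ.+ n)) (X^-*-+ m f n))

  X^-*-< : ∀ {m} f {n} → n ℕ.< m → (X ^ m * f) n ≡ + 0
  X^-*-< {suc m} f {zero}  _         = ⋆-assoc X (X ^ m) f 0
  X^-*-< {suc m} f {suc n} (s≤s n<m) = ≡.trans (⋆-assoc X (X ^ m) f (suc n))
    (≡.trans (X-⋆-suc (X ^ m * f) n) (X^-*-< f n<m))

  X^1+N≈0 : X ^ suc N ≈ 0#
  X^1+N≈0 = trans (sym (*-identityʳ (X ^ suc N))) (mk≈ λ n≤N → ≡ₚ-reflexive (X^-*-< {suc N} 1# (s≤s n≤N)))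

  avoidingSeries : (k b : ℕ) → Carrier
  avoidingSeries k b n = + avoiding k b n

  avoidingSeries-zero : ∀ k → avoidingSeries k 0 ≈ 1#
  avoidingSeries-zero k = exact λ { zero → ≡.refl ; (suc n) → ≡.refl }

  avoidingSeries-suc-≡ : ∀ b → avoidingSeries (suc b) (suc b) ≈ avoidingSeries (suc b) b
  avoidingSeries-suc-≡ b = exact λ n → ≡.cong +_ (avoiding-suc-≡ b n)

  avoidingSeries-suc-≢ : ∀ {k b} → suc b ≢ k → (1# - X ^ suc b) * avoidingSeries k (suc b) ≈ avoidingSeries k b
  avoidingSeries-suc-≢ {k} {b} 1+b≢k = [1-x]y≈z (exact coefficients)
    where
    coefficients : avoidingSeries k (suc b) ≗ avoidingSeries k b + X ^ suc b * avoidingSeries k (suc b)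
    coefficients n with n ℕ.<? suc b
    ... | yes n<1+b = ≡.trans (≡.cong +_ (avoiding-suc-< k n<1+b))
      (≡.trans (≡.sym (ℤ.+-identityʳ (+ avoiding k b n)))
               (≡.cong₂ ℤ._+_ {avoidingSeries k b n} ≡.refl (≡.sym (X^-*-< (avoidingSeries k (suc b)) n<1+b))))
    ... | no n≮1+b = ≡.subst
      (λ n → avoidingSeries k (suc b) n ≡ (avoidingSeries k b + X ^ suc b * avoidingSeries k (suc b)) n)
      (ℕ.m+[n∸m]≡n (ℕ.≮⇒≥ n≮1+b))
      (≡.trans (≡.cong +_ (avoiding-suc-+ (n ℕ.∸ suc b) 1+b≢k))
               (≡.cong₂ ℤ._+_ {avoidingSeries k b (suc b ℕ.+ (n ℕ.∸ suc b))} ≡.refl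
                       (≡.sym (X^-*-+ (suc b) (avoidingSeries k (suc b)) (n ℕ.∸ suc b)))))

  -- No part is 0, so `avoidingSeries 0 b` counts all partitions into parts at most b and is the
  -- inverse of `P b`; the exceptional case of the recurrence never occurs.
  open Products X N X^1+N≈0 (avoidingSeries 0) (avoidingSeries-zero 0) (λ b → avoidingSeries-suc-≢ λ ()) public

  multiple≡ₚ0 : ∀ m → + (p ℕ.* m) ≡ₚ + 0
  multiple≡ₚ0 m = ∣⇒≡ₚ0 (ℤ.divides (+ m) (≡.trans (≡.cong +_ (ℕ.*-comm p m)) (ℤ.pos-* m p)))

  multiple+≡ₚ : ∀ m r → + (p ℕ.* m ℕ.+ r) ≡ₚ + r
  multiple+≡ₚ m r = +-congₚ (multiple≡ₚ0 m) (≡ₚ-refl {+ r})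

  -- Every factor of `P b` is absorbed by the recurrence of the series, except that of index p, for
  -- which no parts are counted. The product is 1 for b < p and 1 - q^p from then on.
  homogeneous-P*avoiding : ∀ b → Homogeneous (+ 0) (P b * avoidingSeries p b)
  homogeneous-P*avoiding zero = supported-≈
    (trans (sym (*-identityˡ 1#)) (*-congˡ {1#} (sym (avoidingSeries-zero p))))
    homogeneous-1
  homogeneous-P*avoiding (suc b) = by-cases (suc b ℕ.≟ p)
    where
    by-cases : Dec (suc b ≡ p) → Homogeneous (+ 0) (P (suc b) * avoidingSeries p (suc b))
    by-cases (no 1+b≢p) = supported-≈
      (trans (*-congˡ {P b} (sym (avoidingSeries-suc-≢ 1+b≢p)))
             (sym (*-assoc (P b) (1# - X ^ suc b) (avoidingSeries p (suc b)))))
      (homogeneous-P*avoiding b)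
    by-cases (yes ≡.refl) = supported-≈
      (trans (trans (*-assoc (P b) (avoidingSeries p b) (1# - X ^ p))
                    (*-congˡ {P b} (trans (*-comm (avoidingSeries p b) (1# - X ^ p))
                                          (*-congˡ {1# - X ^ p} (sym (avoidingSeries-suc-≡ b))))))
             (sym (*-assoc (P b) (1# - X ^ p) (avoidingSeries p p))))
      (homogeneous-⋆ (homogeneous-P*avoiding b)
        (supported-+ homogeneous-1 (supported-neg
          (homogeneous-≡ₚ (∣⇒≡ₚ0 ℤ.∣-refl) (homogeneous-X^ p)))))

  homogeneous-t : ∀ k → Homogeneous (+ tri k) (t k)
  homogeneous-t zero    = homogeneous-1
  homogeneous-t (suc k) = supported-neg (homogeneous-⋆ (homogeneous-X^ (suc k)) (homogeneous-t k))

  supported-Σ< : ∀ {A : ℕ → Set} m (f : ℕ → Carrier) → (∀ k → SupportedOn A (f k)) → SupportedOn A (Σ< m f)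
  supported-Σ< zero    f f-supp = supported-0
  supported-Σ< (suc m) f f-supp = supported-+ (supported-Σ< m f f-supp) (f-supp m)

  homogeneous⇒supported : ∀ {m} {w : Vec ℤ m} {r f} →
    Any (r ≡ₚ_) w → Homogeneous r f → SupportedOn (Residues w) f
  homogeneous⇒supported r∈w = supported-⊆ (λ n≡r → Any.map (≡ₚ-trans n≡r) r∈w)

  -- The first alternative is essential in the applications: where p divides 2k+1, the triangular
  -- number falls outside the listed residues and only the vanishing coefficient helps.
  supported-P³ : ∀ {m} {w : Vec ℤ m} →
    (∀ k → + suc (2 ℕ.* k) ≡ₚ + 0 ⊎ Any (+ tri k ≡ₚ_) w) → SupportedOn (Residues w) (P N ^ 3)
  supported-P³ {w = w} residues = supported-≈ (sym P³≈Σ-odd*t) (supported-Σ< (suc N) (λ k → odd k * t k) term)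
    where
    term : ∀ k → SupportedOn (Residues w) (odd k * t k)
    term k = Sum.[ odd-vanishes , tri-residue ]′ (residues k)
      where
      odd-vanishes : + suc (2 ℕ.* k) ≡ₚ + 0 → SupportedOn (Residues w) (odd k * t k)
      odd-vanishes odd≡0 = supported-≈
        (trans (sym (zeroˡ (t k))) (*-congʳ {t k} (sym (constant≈0 (+ suc (2 ℕ.* k)) (≡ₚ0⇒∣ odd≡0))))) supported-0

      tri-residue : Any (+ tri k ≡ₚ_) w → SupportedOn (Residues w) (odd k * t k)
      tri-residue tri∈w = homogeneous⇒supported tri∈w
        (homogeneous-⋆ (homogeneous-constant (+ suc (2 ℕ.* k))) (homogeneous-t k))

  supported-P : ∀ {m} {w : Vec ℤ m} → Any (+ 0 ≡ₚ_) w →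
    (∀ n → Any (+ (tri (suc n) ℕ.+ suc n ℕ.* suc n) ≡ₚ_) w × Any (+ (tri n ℕ.+ suc n ℕ.* suc n) ≡ₚ_) w) →
    SupportedOn (Residues w) (P N)
  supported-P {w = w} 0∈w residues = supported-≈ (sym P≈pentagonal) (pentagonal-supp N)
    where
    term : ∀ k n → Any (+ (tri k ℕ.+ suc n ℕ.* suc n) ≡ₚ_) w →
      SupportedOn (Residues w) (t k * X ^ (suc n ℕ.* suc n))
    term k n e∈w = homogeneous⇒supported e∈w
      (homogeneous-⋆ (homogeneous-t k) (homogeneous-X^ (suc n ℕ.* suc n)))

    pentagonal-supp : ∀ n → SupportedOn (Residues w) (pentagonal n)
    pentagonal-supp zero    = homogeneous⇒supported 0∈w homogeneous-1
    pentagonal-supp (suc n) = supported-+ (pentagonal-supp n)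
      (supported-≈ (sym ([y-z]x≈yx-zx (X ^ (suc n ℕ.* suc n)) (t (suc n)) (t n)))
        (supported-+ (term (suc n) n (proj₁ (residues n)))
          (supported-neg (term n n (proj₂ (residues n))))))

  -- For odd p the witness c is (p+1)/2; it makes triangular numbers periodic modulo p, which leaves
  -- one period of residues to check.
  module _ {c} (tri-p : tri p ≡ p ℕ.* c) .{{_ : ℕ.NonZero p}} {m} {w : Vec ℤ m} where

    tri-shift : ∀ k → tri (p ℕ.+ k) ≡ p ℕ.* (c ℕ.+ k) ℕ.+ tri k
    tri-shift k = ≡.trans (tri-+ p k)
      (≡.trans (≡.cong (λ s → s ℕ.+ tri k ℕ.+ p ℕ.* k) tri-p) (rearrange p c k (tri k)))
      where
      rearrange : ∀ p c k s → p ℕ.* c ℕ.+ s ℕ.+ p ℕ.* k ≡ p ℕ.* (c ℕ.+ k) ℕ.+ s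
      rearrange = ℕ-solve-∀

    shift∈ : ∀ {e e′} q → e′ ≡ p ℕ.* q ℕ.+ e → Any (+ e ≡ₚ_) w → Any (+ e′ ≡ₚ_) w
    shift∈ q ≡.refl = Any.map (≡ₚ-trans (multiple+≡ₚ q _))

    jacobi-residues :
      (∀ {k} → k ℕ.< p → + suc (2 ℕ.* k) ≡ₚ + 0 ⊎ Any (+ tri k ≡ₚ_) w) →
      ∀ k → + suc (2 ℕ.* k) ≡ₚ + 0 ⊎ Any (+ tri k ≡ₚ_) w
    jacobi-residues = periodic p λ k → Sum.map
      (λ odd≡0 → ≡ₚ-trans (≡ₚ-reflexive (≡.cong +_ (rearrange p k)))
        (≡ₚ-trans (multiple+≡ₚ 2 (suc (2 ℕ.* k))) odd≡0))
      (shift∈ (c ℕ.+ k) (tri-shift k))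
      where
      rearrange : ∀ p k → suc (2 ℕ.* (p ℕ.+ k)) ≡ p ℕ.* 2 ℕ.+ suc (2 ℕ.* k)
      rearrange = ℕ-solve-∀

    euler-residues :
      (∀ {n} → n ℕ.< p →
        Any (+ (tri (suc n) ℕ.+ suc n ℕ.* suc n) ≡ₚ_) w × Any (+ (tri n ℕ.+ suc n ℕ.* suc n) ≡ₚ_) w) →
      ∀ n → Any (+ (tri (suc n) ℕ.+ suc n ℕ.* suc n) ≡ₚ_) w × Any (+ (tri n ℕ.+ suc n ℕ.* suc n) ≡ₚ_) w
    euler-residues = periodic p λ n (e₁∈w , e₂∈w) →
        shift∈ _
          (≡.trans (≡.cong (λ s → suc (p ℕ.+ n) ℕ.+ s ℕ.+ suc (p ℕ.+ n) ℕ.* suc (p ℕ.+ n)) (tri-shift n))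
                   (rearrange₁ p c n (tri n)))
          e₁∈w
      , shift∈ _
          (≡.trans (≡.cong (ℕ._+ suc (p ℕ.+ n) ℕ.* suc (p ℕ.+ n)) (tri-shift n))
                   (rearrange₂ p c n (tri n)))
          e₂∈w
      where
      rearrange₁ : ∀ p c n s → suc (p ℕ.+ n) ℕ.+ (p ℕ.* (c ℕ.+ n) ℕ.+ s) ℕ.+ suc (p ℕ.+ n) ℕ.* suc (p ℕ.+ n)
        ≡ p ℕ.* (c ℕ.+ 3 ℕ.* (1 ℕ.+ n) ℕ.+ p) ℕ.+ (suc n ℕ.+ s ℕ.+ suc n ℕ.* suc n)
      rearrange₁ = ℕ-solve-∀

      rearrange₂ : ∀ p c n s → p ℕ.* (c ℕ.+ n) ℕ.+ s ℕ.+ suc (p ℕ.+ n) ℕ.* suc (p ℕ.+ n)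
        ≡ p ℕ.* (c ℕ.+ n ℕ.+ 2 ℕ.* suc n ℕ.+ p) ℕ.+ (s ℕ.+ suc n ℕ.* suc n)
      rearrange₂ = ℕ-solve-∀

  module _ (frobenius : ∀ x → (1# - x) ^ p ≈ 1# - x ^ p) where

    homogeneous-P^p : ∀ b → Homogeneous (+ 0) (P b ^ p)
    homogeneous-P^p zero    = homogeneous-≡ₚ (≡ₚ-reflexive (ℤ.*-zeroʳ (+ p))) (homogeneous-^ p homogeneous-1)
    homogeneous-P^p (suc b) = supported-≈
      (sym (trans (^-distrib-* (P b) (1# - X ^ suc b) p) (*-congˡ {P b ^ p} (frobenius (X ^ suc b)))))
      (homogeneous-⋆ (homogeneous-P^p b)
        (supported-+ homogeneous-1 (supported-neg
          (homogeneous-≡ₚ (≡ₚ-trans (≡ₚ-reflexive (≡.sym (ℤ.pos-* p (suc b)))) (multiple≡ₚ0 (suc b)))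
            (homogeneous-^ p (homogeneous-X^ (suc b)))))))

    homogeneous-P^p*j : ∀ j → Homogeneous (+ 0) (P N ^ (p ℕ.* j))
    homogeneous-P^p*j j = supported-≈ (^-assocʳ (P N) p j)
      (homogeneous-≡ₚ (≡ₚ-reflexive (ℤ.*-zeroʳ (+ j))) (homogeneous-^ j (homogeneous-P^p N)))

    divides-avoiding : ∀ k j r → suc (3 ℕ.* k) ≡ p ℕ.* j → component r ((P N ^ 3) ^ k) ≈ 0# →
      + N ≡ₚ r → + p ℤ.∣ avoidingSeries p N N
    divides-avoiding k j r 1+3k≡pj component≈0 N≡r =
      -- N itself lies in class r and is the last exponent that survives truncation, so the
      -- vanishing of the component gives the coefficient of V at N, where the bound N on the parts
      -- is vacuous.
      ≡ₚ0⇒∣ (≡ₚ-trans (≡ₚ-reflexive (≡.sym (component-≡ V N≡r))) (coefficient component-V≈0 ℕ.≤-refl))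
      where
      open import Relation.Binary.Reasoning.Setoid setoid

      E V : Carrier
      E = P N
      V = avoidingSeries p N

      E^pj*V : E ^ (p ℕ.* j) * V ≈ (E * V) * (E ^ 3) ^ k
      E^pj*V = begin
        E ^ (p ℕ.* j) * V         ≡⟨ ≡.cong (λ i → E ^ i * V) 1+3k≡pj ⟨
        (E * E ^ (3 ℕ.* k)) * V   ≈⟨ *-congʳ {V} (*-congˡ {E} (^-assocʳ E 3 k)) ⟨
        (E * (E ^ 3) ^ k) * V     ≈⟨ *-assoc E ((E ^ 3) ^ k) V ⟩
        E * ((E ^ 3) ^ k * V)     ≈⟨ *-congˡ {E} (*-comm ((E ^ 3) ^ k) V) ⟩
        E * (V * (E ^ 3) ^ k)     ≈⟨ *-assoc E V ((E ^ 3) ^ k) ⟨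
        (E * V) * (E ^ 3) ^ k     ∎

      component-V≈0 : component r V ≈ 0#
      component-V≈0 = P^-cancel N (p ℕ.* j) (begin
        E ^ (p ℕ.* j) * component r V         ≈⟨ component-⋆₀ r (E ^ (p ℕ.* j)) V (homogeneous-P^p*j j) ⟨
        component r (E ^ (p ℕ.* j) * V)       ≈⟨ component-cong r E^pj*V ⟩
        component r ((E * V) * (E ^ 3) ^ k)   ≈⟨ component-⋆₀ r (E * V) ((E ^ 3) ^ k) (homogeneous-P*avoiding N) ⟩
        (E * V) * component r ((E ^ 3) ^ k)   ≈⟨ *-congˡ {E * V} component≈0 ⟩
        (E * V) * 0#                          ≈⟨ zeroʳ (E * V) ⟩
        0#                                    ∎)

-- The primes 5, 7 and 11

weights₅ : Vec ℤ 2
weights₅ = + 0 ∷ + 1 ∷ []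

weights₇ : Vec ℤ 3
weights₇ = + 0 ∷ + 1 ∷ + 3 ∷ []

weights₁₁ : Vec ℤ 5
weights₁₁ = + 0 ∷ + 1 ∷ + 3 ∷ + 6 ∷ + 10 ∷ []

pentagonal-residues₁₁ : Vec ℤ 6
pentagonal-residues₁₁ = + 0 ∷ + 1 ∷ + 2 ∷ + 4 ∷ + 5 ∷ + 7 ∷ []

-- Stated over an arbitrary ring in which multiples of 5 vanish, so that the polynomial computations
-- do not involve series or n.
module Characteristic₅
  (R : CommutativeRing 0ℓ 0ℓ) (constants : ℤ-Constants R)
  (p≈0 : Multiples≈0 5 R constants)
  where

  open CommutativeRing R hiding (zero)
  open _-Raw-AlmostCommutative⟶_ constants using (0-homo)
  open import Algebra.Properties.Semiring.Exp semiring using (_^_)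
  open import Algebra.Properties.Group +-group using (x∙y⁻¹≈ε⇒x≈y)
  open Characteristic 5 R constants p≈0

  frobenius : ∀ x → (1# - x) ^ 5 ≈ 1# - x ^ 5
  frobenius x = x∙y⁻¹≈ε⇒x≈y _ _ (trans
    (solve 1 (λ x → (con (+ 1) :^ 0 :- x) :^ 5 :- (con (+ 1) :^ 0 :- x :^ 5) := con (+ 0)) refl x) 0-homo)

  power-component≈0 : ∀ ρ → ⟦ power-component weights₅ 3 (+ 4) ⟧ ρ ≈ 0#
  power-component≈0 ρ = trans (prove ρ (power-component weights₅ 3 (+ 4)) (con (+ 0)) refl) 0-homo

module Characteristic₇
  (R : CommutativeRing 0ℓ 0ℓ) (constants : ℤ-Constants R)
  (p≈0 : Multiples≈0 7 R constants)
  where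

  open CommutativeRing R hiding (zero)
  open _-Raw-AlmostCommutative⟶_ constants using (0-homo)
  open import Algebra.Properties.Semiring.Exp semiring using (_^_)
  open import Algebra.Properties.Group +-group using (x∙y⁻¹≈ε⇒x≈y)
  open Characteristic 7 R constants p≈0

  frobenius : ∀ x → (1# - x) ^ 7 ≈ 1# - x ^ 7
  frobenius x = x∙y⁻¹≈ε⇒x≈y _ _ (trans
    (solve 1 (λ x → (con (+ 1) :^ 0 :- x) :^ 7 :- (con (+ 1) :^ 0 :- x :^ 7) := con (+ 0)) refl x) 0-homo)

  power-component≈0 : ∀ ρ → ⟦ power-component weights₇ 2 (+ 5) ⟧ ρ ≈ 0#
  power-component≈0 ρ = trans (prove ρ (power-component weights₇ 2 (+ 5)) (con (+ 0)) refl) 0-homo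

module Characteristic₁₁
  (R : CommutativeRing 0ℓ 0ℓ) (constants : ℤ-Constants R)
  (p≈0 : Multiples≈0 11 R constants)
  where

  open CommutativeRing R hiding (zero)
  open _-Raw-AlmostCommutative⟶_ constants using (0-homo)
  open import Algebra.Properties.Semiring.Exp semiring using (_^_)
  open import Algebra.Properties.Group +-group using (x∙y⁻¹≈ε⇒x≈y)
  open Characteristic 11 R constants p≈0

  frobenius : ∀ x → (1# - x) ^ 11 ≈ 1# - x ^ 11
  frobenius x = x∙y⁻¹≈ε⇒x≈y _ _ (trans
    (solve 1 (λ x → (con (+ 1) :^ 0 :- x) :^ 11 :- (con (+ 1) :^ 0 :- x :^ 11) := con (+ 0)) refl x) 0-homo)

  -- The cofactors in combination come from linear algebra over 𝔽₁₁. The squares of 𝔽₁₁ act on the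
  -- residues (as 8r + 1) through a 5-cycle of a, b, c, d, e, which also permutes the five summands.
  power-component≈0 : ∀ ρ → let g = λ r → ⟦ power-component weights₁₁ 4 (+ r) ⟧ ρ in
    g 3 ≈ 0# → g 6 ≈ 0# → g 8 ≈ 0# → g 9 ≈ 0# → g 10 ≈ 0# → ⟦ power-component weights₁₁ 7 (+ 6) ⟧ ρ ≈ 0#
  power-component≈0 ρ g₃≈0 g₆≈0 g₈≈0 g₉≈0 g₁₀≈0 = trans
    (x∙y⁻¹≈ε⇒x≈y _ _ (trans (prove ρ (power-component weights₁₁ 7 (+ 6) :- combination) (con (+ 0)) refl) 0-homo))
    (x+y≈0 (x+y≈0 (x+y≈0 (x+y≈0 (y≈0⇒x*y≈0 g₃≈0) (y≈0⇒x*y≈0 g₆≈0))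
      (y≈0⇒x*y≈0 g₈≈0)) (y≈0⇒x*y≈0 g₉≈0)) (y≈0⇒x*y≈0 g₁₀≈0))
    where
    a b c d e combination : Polynomial 5
    a = var 0F
    b = var 1F
    c = var 2F
    d = var 3F
    e = var 4F
    -- The variables are the parts of E³ in classes 0, 1, 3, 6, 10. The cofactor of the part of
    -- class r has weight 6 - r modulo 11, so each summand lies in class 6.
    combination =
      (con (+ 4) :* a :* a :* c :- b :* c :* e :- b :* b :* b) :* power-component weights₁₁ 4 (+ 3) :+
      (con (+ 4) :* d :* d :* e :- a :* b :* e :- a :* a :* a) :* power-component weights₁₁ 4 (+ 6) :+
      (con (+ 4) :* a :* e :* e :- a :* c :* d :- c :* c :* c) :* power-component weights₁₁ 4 (+ 8) :+
      (con (+ 4) :* b :* b :* d :- c :* d :* e :- e :* e :* e) :* power-component weights₁₁ 4 (+ 9) :+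
      (con (+ 4) :* b :* c :* c :- a :* b :* d :- d :* d :* d) :* power-component weights₁₁ 4 (+ 10)

    y≈0⇒x*y≈0 : ∀ {x y} → y ≈ 0# → x * y ≈ 0#
    y≈0⇒x*y≈0 {x} y≈0 = trans (*-congˡ y≈0) (zeroʳ x)

    x+y≈0 : ∀ {x y} → x ≈ 0# → y ≈ 0# → x + y ≈ 0#
    x+y≈0 x≈0 y≈0 = trans (+-cong x≈0 y≈0) (+-identityˡ 0#)

module _ (n : ℕ) where
  private N = 5 ℕ.* n ℕ.+ 4
  open TruncatedSeries 5 N hiding (_≈_)
  open CommutativeRing commutativeRing hiding (zero)
  open import Algebra.Properties.Semiring.Exp semiring using (_^_)
  open Components 5 N
  open Partitions 5 N
  open Characteristic₅ commutativeRing constants constant≈0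

  private
    distinct : Distinct weights₅
    distinct = from-yes (allPairs? (λ r s → ¬? (r ≡ₚ? s)) weights₅)

    residues : ∀ {k} → k ℕ.< 5 → + suc (2 ℕ.* k) ≡ₚ + 0 ⊎ Any (+ tri k ≡ₚ_) weights₅
    residues = from-yes (ℕ.allUpTo? (λ k → + suc (2 ℕ.* k) ≡ₚ? + 0 ⊎-dec any? (+ tri k ≡ₚ?_) weights₅) 5)

    P³-supported : SupportedOn (Residues weights₅) (P N ^ 3)
    -- 15 = 5 · 3 is the fifth triangular number.
    P³-supported = supported-P³ (jacobi-residues {3} ≡.refl residues)

  5∣ν[5n+4] : 5 ℕ.∣ ν 5 N
  -- The exponents k = 3 and j = 2 satisfy 1 + 3 · 3 = 5 · 2; likewise 1 + 3 · 2 = 7 · 1 and 1 + 3 ·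
  -- 7 = 11 · 2 for the other primes.
  5∣ν[5n+4] = ℤ.∣⇒∣ᵤ (divides-avoiding frobenius 3 2 (+ 4) ≡.refl component≈0 (multiple+≡ₚ n 4))
    where
    component≈0 : component (+ 4) ((P N ^ 3) ^ 3) ≈ 0#
    component≈0 = trans (component-^ weights₅ (P N ^ 3) distinct P³-supported 3 (+ 4))
      (power-component≈0 (components weights₅ (P N ^ 3)))

module _ (n : ℕ) where
  private N = 7 ℕ.* n ℕ.+ 5
  open TruncatedSeries 7 N hiding (_≈_)
  open CommutativeRing commutativeRing hiding (zero)
  open import Algebra.Properties.Semiring.Exp semiring using (_^_)
  open Components 7 N
  open Partitions 7 N
  open Characteristic₇ commutativeRing constants constant≈0

  private
    distinct : Distinct weights₇
    distinct = from-yes (allPairs? (λ r s → ¬? (r ≡ₚ? s)) weights₇)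

    residues : ∀ {k} → k ℕ.< 7 → + suc (2 ℕ.* k) ≡ₚ + 0 ⊎ Any (+ tri k ≡ₚ_) weights₇
    residues = from-yes (ℕ.allUpTo? (λ k → + suc (2 ℕ.* k) ≡ₚ? + 0 ⊎-dec any? (+ tri k ≡ₚ?_) weights₇) 7)

    P³-supported : SupportedOn (Residues weights₇) (P N ^ 3)
    P³-supported = supported-P³ (jacobi-residues {4} ≡.refl residues)

  7∣ν[7n+5] : 7 ℕ.∣ ν 7 N
  7∣ν[7n+5] = ℤ.∣⇒∣ᵤ (divides-avoiding frobenius 2 1 (+ 5) ≡.refl component≈0 (multiple+≡ₚ n 5))
    where
    component≈0 : component (+ 5) ((P N ^ 3) ^ 2) ≈ 0#
    component≈0 = trans (component-^ weights₇ (P N ^ 3) distinct P³-supported 2 (+ 5))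
      (power-component≈0 (components weights₇ (P N ^ 3)))

module _ (n : ℕ) where
  private N = 11 ℕ.* n ℕ.+ 6
  open TruncatedSeries 11 N hiding (_≈_)
  open CommutativeRing commutativeRing hiding (zero)
  open import Algebra.Properties.Semiring.Exp semiring using (_^_; ^-assocʳ)
  open Components 11 N
  open Partitions 11 N
  open Characteristic 11 commutativeRing constants constant≈0 using (⟦_⟧; power-component)
  open Characteristic₁₁ commutativeRing constants constant≈0

  private
    distinct : Distinct weights₁₁
    distinct = from-yes (allPairs? (λ r s → ¬? (r ≡ₚ? s)) weights₁₁)

    residues : ∀ {k} → k ℕ.< 11 → + suc (2 ℕ.* k) ≡ₚ + 0 ⊎ Any (+ tri k ≡ₚ_) weights₁₁
    residues = from-yes (ℕ.allUpTo? (λ k → + suc (2 ℕ.* k) ≡ₚ? + 0 ⊎-dec any? (+ tri k ≡ₚ?_) weights₁₁) 11)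

    P³-supported : SupportedOn (Residues weights₁₁) (P N ^ 3)
    P³-supported = supported-P³ (jacobi-residues {6} ≡.refl residues)

    P-supported : SupportedOn (Residues pentagonal-residues₁₁) (P N)
    P-supported = supported-P (from-yes (any? (+ 0 ≡ₚ?_) pentagonal-residues₁₁)) (euler-residues {6} ≡.refl
      (from-yes (ℕ.allUpTo? (λ n →
        any? (+ (tri (suc n) ℕ.+ suc n ℕ.* suc n) ≡ₚ?_) pentagonal-residues₁₁ ×-dec
        any? (+ (tri n ℕ.+ suc n ℕ.* suc n) ≡ₚ?_) pentagonal-residues₁₁) 11)))

    fourth-power≈0 : ∀ r → ¬ Any (r ≡ₚ_) pentagonal-residues₁₁ →
      ⟦ power-component weights₁₁ 4 r ⟧ (components weights₁₁ (P N ^ 3)) ≈ 0#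
    fourth-power≈0 r r∉ = begin
      ⟦ power-component weights₁₁ 4 r ⟧ (components weights₁₁ (P N ^ 3))
        ≈⟨ component-^ weights₁₁ (P N ^ 3) distinct P³-supported 4 r ⟨
      component r ((P N ^ 3) ^ 4)
        ≈⟨ component-cong r (trans (^-assocʳ (P N) 3 4) (*-comm (P N) (P N ^ 11))) ⟩
      component r (P N ^ 11 * P N)
        ≈⟨ component-⋆₀ r (P N ^ 11) (P N) (homogeneous-P^p frobenius N) ⟩
      P N ^ 11 * component r (P N)
        ≈⟨ *-congˡ {P N ^ 11} (component-outside pentagonal-residues₁₁ r (P N) r∉ P-supported) ⟩
      P N ^ 11 * 0#
        ≈⟨ zeroʳ (P N ^ 11) ⟩
      0# ∎
      where open import Relation.Binary.Reasoning.Setoid setoid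

  11∣ν[11n+6] : 11 ℕ.∣ ν 11 N
  11∣ν[11n+6] = ℤ.∣⇒∣ᵤ (divides-avoiding frobenius 7 2 (+ 6) ≡.refl component≈0 (multiple+≡ₚ n 6))
    where
    component≈0 : component (+ 6) ((P N ^ 3) ^ 7) ≈ 0#
    component≈0 = trans (component-^ weights₁₁ (P N ^ 3) distinct P³-supported 7 (+ 6))
      (power-component≈0 (components weights₁₁ (P N ^ 3))
        (fourth-power≈0 (+ 3) (from-no (any? (+ 3 ≡ₚ?_) pentagonal-residues₁₁)))
        (fourth-power≈0 (+ 6) (from-no (any? (+ 6 ≡ₚ?_) pentagonal-residues₁₁)))
        (fourth-power≈0 (+ 8) (from-no (any? (+ 8 ≡ₚ?_) pentagonal-residues₁₁)))
        (fourth-power≈0 (+ 9) (from-no (any? (+ 9 ≡ₚ?_) pentagonal-residues₁₁)))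
        (fourth-power≈0 (+ 10) (from-no (any? (+ 10 ≡ₚ?_) pentagonal-residues₁₁))))

open import Data.Nat using (_+_; _*_; _≤_)
open import Data.Nat.Divisibility using (_∣_)

mainTheorem7 : (n : ℕ) → 1 ≤ n →
    (5 ∣ ν 5 (5 * n + 4)) ×
    (7 ∣ ν 7 (7 * n + 5)) ×
    (11 ∣ ν 11 (11 * n + 6))
mainTheorem7 n _ = 5∣ν[5n+4] n , 7∣ν[7n+5] n , 11∣ν[11n+6] n
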